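{- Let $p,q\in\mathbb N$ be coprime with $p<q$. Then the number of $(p,q)$-tilted Sperner families in $\mathcal P(n)$ is $$2^{(q-p+o(1))\binom{n}{\lfloor n/2\rfloor}},$$ where $o(1)\to 0$ as $n\to\infty$.
   Context: $\mathcal P(n)$ denotes the family of all subsets of $[n]=\{1,\dots,n\}$. For $p,q\in\mathbb N$, a family $\mathcal A\subseteq\mathcal P(n)$ is a $(p,q)$-tilted Sperner family if $\mathcal A$ does not contain two distinct sets $A,B$ with $q|A\setminus B|=p|B\setminus A|$. (The paper omits floors and ceilings; $\binom{n}{n/2}$ is read as $\binom{n}{\lfloor n/2\rfloor}$.) -}

module Defs where

open import Data.Nat using (ℕ; zero; suc; _*_; _≟_; ⌊_/2⌋)
open import Data.Nat.Combinatorics using (_C_)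
open import Data.Bool using (Bool; true; false)
open import Data.Vec using ([]; _∷_)
open import Data.List using (List; []; _∷_; [_]; map; _++_; filter; length)
open import Data.Fin.Subset using (Subset; inside; outside; _─_; ∣_∣)
open import Data.List.Relation.Unary.AllPairs using (AllPairs; allPairs?)
open import Data.Product using (_×_)
open import Relation.Binary.PropositionalEquality using (_≡_)
open import Relation.Nullary using (¬_; ¬?)
open import Relation.Nullary.Decidable using (_×-dec_)

allSubsets : (n : ℕ) → List (Subset n)
allSubsets zero = [ [] ]
allSubsets (suc n) = map (inside ∷_) (allSubsets n) ++ map (outside ∷_) (allSubsets n)

-- All sublists (subsequences) of a list; sublists of allSubsets n are
-- in bijection with families 𝒜 ⊆ 𝒫(n).
sublists : {A : Set} → List A → List (List A)
sublists [] = [ [] ]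
sublists (x ∷ xs) = map (x ∷_) (sublists xs) ++ sublists xs

NotTilted : (p q : ℕ) {n : ℕ} → Subset n → Subset n → Set
NotTilted p q A B = (¬ (q * ∣ A ─ B ∣ ≡ p * ∣ B ─ A ∣)) × (¬ (q * ∣ B ─ A ∣ ≡ p * ∣ A ─ B ∣))

-- A family (list of pairwise distinct sets) is (p,q)-tilted Sperner.
IsTiltedSperner : (p q : ℕ) {n : ℕ} → List (Subset n) → Set
IsTiltedSperner p q 𝒜 = AllPairs (NotTilted p q) 𝒜

numTiltedSperner : (p q n : ℕ) → ℕ
numTiltedSperner p q n =
  length (filter (allPairs? (λ A B → ¬? (q * ∣ A ─ B ∣ ≟ p * ∣ B ─ A ∣) ×-dec ¬? (q * ∣ B ─ A ∣ ≟ p * ∣ A ─ B ∣)))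
                 (sublists (allSubsets n)))

middleBinom : ℕ → ℕ
middleBinom n = n C ⌊ n /2⌋

{-# OPTIONS --safe #-}

-- Put s = q - p and B = C(n , ⌊n/2⌋), and join two sets when they form a forbidden pair, so that
-- the families counted are the independent sets of a graph on the subsets of [n].
--
-- Lower bound: a forbidden pair with |A ∖ B| = p t, |B ∖ A| = q t lies on levels s t apart, so all
-- subfamilies of the s consecutive levels starting at ⌊n/2⌋ qualify, and these levels have size
-- (s - o(1)) B.
--
-- Upper bound: read an ordering of [n] through sliding windows of positions p j, …, l + q j - 1.
-- This gives chains of sets any two of which are joined, and s families of such chains cover the
-- levels within Ω(n) of the middle.  Averaging over all orderings shows that a family of more than
-- (s + o(1)) B sets has a member joined to at least d others, for any d = o(n); the sets off
-- these levels are disposed of by Chebyshev's inequality.  An independent set avoids such a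
-- member or all its d neighbours, so the number i(u) of independent sets among u sets satisfies
-- i(u) ≤ i(u - 1) + i(u - 1 - d) as long as u > (s + o(1)) B.  Solving the recursion with d of
-- order √n log n gives the bound because 2^n = O(√n B).
module Submission where

open import Defs
import Data.Bool
open import Data.Bool using (Bool; true; false; _∧_; not; T)
open import Data.Bool.Properties using (∧-comm)
open import Data.Empty using (⊥-elim)
open import Data.Fin.Subset using (Subset; inside; outside; _─_; ∣_∣)
open import Data.Fin.Subset.Properties using (∣p∣≤n)
open import Data.List using (List; []; _∷_; [_]; map; _++_; filter; length; downFrom; concatMap)
open import Data.List.Membership.Propositional using (_∈_; find; lose)
open import Data.List.Membership.Propositional.Properties
  using (∈-map⁺; ∈-map⁻; ∈-++⁺ˡ; ∈-++⁺ʳ; ∈-concatMap⁻; ∈-downFrom⁺; ∈-downFrom⁻)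
open import Data.List.Properties using (length-downFrom)
open import Data.List.Relation.Unary.All as All using (All; []; _∷_; all?)
open import Data.List.Relation.Unary.AllPairs using ([]; _∷_; allPairs?)
open import Data.List.Relation.Unary.Any using (here; there; any?)
open import Data.List.Relation.Unary.Unique.Propositional using (Unique)
open import Data.List.Relation.Unary.Unique.Propositional.Properties
  using () renaming (map⁺ to Unique-map⁺; ++⁺ to Unique-++⁺)
open import Data.Nat
open import Data.Nat.Combinatorics
  using (_C_; nCk≡n!/k![n-k]!; nCk+nC[k+1]≡[n+1]C[k+1]; nCk≡nC[n∸k]; k![n∸k]!∣n!; k>n⇒nCk≡0; nCn≡1)
open import Data.Nat.Coprimality as Coprimality using (Coprime; coprime-divisor)
open import Data.Nat.DivMod using (m≡m%n+[m/n]*n; m%n<n; m/n*n≤m; m*n/n≡m; /-monoˡ-≤; m/n*n≡m)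
open import Data.Nat.Divisibility using (divides)
open import Data.Nat.Properties
open import Data.Nat.Tactic.RingSolver using (solve-∀)
open import Data.Product using (Σ; ∃; _×_; _,_; proj₁; proj₂)
open import Data.Sum using (_⊎_; inj₁; inj₂)
open import Data.Vec as Vec using (Vec; []; _∷_)
open import Data.Vec.Properties using (∷-injectiveʳ; ≡-dec)
open import Function using (_∘_)
open import Relation.Binary.PropositionalEquality
  using (_≡_; _≢_; refl; sym; trans; cong; cong₂; subst; subst₂; module ≡-Reasoning)
open import Relation.Nullary using (¬_; Dec; yes; no; does; ¬?)
open import Relation.Nullary.Decidable using (_×-dec_; dec-true; dec-false)
open import Algebra.Properties.CommutativeSemigroup *-commutativeSemigroup using (x∙yz≈y∙xz)

-- When p > 0, no two sets of a nested chain are joined, so a chain must drop elements at one end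
-- while gaining them at the other; hence the windows. The averaging rests on a conditional
-- probability: given that A is the i-th set of a random chain, a fixed B is its j-th set (j > i)
-- with probability at most 1/Y, where Y positions lie beyond all windows and Y is linear in n. If
-- every member of a family has at most e neighbours, the mean number X of members on a chain
-- therefore satisfies X ≤ 1 + (e/Y) X, which is 1 + o(1) for e = o(n). On the other hand, each set
-- near the middle lies on a chain of one of the s kinds with probability at least 1/B. The degree d
-- is squeezed from two sides. With d about L 2^L the recursion costs 2^n / 2^L in the exponent,
-- which is o(B) only if 2^L dominates √n, while the averaging wants L 2^L = o(n). The room between
-- √n log n and n is what the proof uses. All of this is done in natural numbers: o(1) becomes 1/k
-- for each k, means become sums over the n! orderings, fractions are cleared and roots are squared
-- away.

⟦_⟧ : Bool → ℕ
⟦ true ⟧  = 1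
⟦ false ⟧ = 0

⟦⟧≤1 : ∀ b → ⟦ b ⟧ ≤ 1
⟦⟧≤1 true  = ≤-refl
⟦⟧≤1 false = z≤n

⟦∧⟧ : ∀ a b → ⟦ a ∧ b ⟧ ≡ ⟦ a ⟧ * ⟦ b ⟧
⟦∧⟧ true  b = sym (+-identityʳ _)
⟦∧⟧ false b = refl

⟦⟧*≤ : ∀ b x → ⟦ b ⟧ * x ≤ x
⟦⟧*≤ true  x = ≤-reflexive (+-identityʳ x)
⟦⟧*≤ false x = z≤n

-- Summation over lists

module _ {A : Set} where

  ∑ : List A → (A → ℕ) → ℕ
  ∑ []       f = 0
  ∑ (x ∷ xs) f = f x + ∑ xs f

  ∑-mono : ∀ xs {f g : A → ℕ} → (∀ x → x ∈ xs → f x ≤ g x) → ∑ xs f ≤ ∑ xs g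
  ∑-mono []       h = z≤n
  ∑-mono (x ∷ xs) h = +-mono-≤ (h x (here refl)) (∑-mono xs λ y y∈ → h y (there y∈))

  ∑-cong : ∀ xs {f g : A → ℕ} → (∀ x → x ∈ xs → f x ≡ g x) → ∑ xs f ≡ ∑ xs g
  ∑-cong []       h = refl
  ∑-cong (x ∷ xs) h = cong₂ _+_ (h x (here refl)) (∑-cong xs λ y y∈ → h y (there y∈))

  ∑-+ : ∀ xs (f g : A → ℕ) → ∑ xs (λ x → f x + g x) ≡ ∑ xs f + ∑ xs g
  ∑-+ []       f g = refl
  ∑-+ (x ∷ xs) f g = trans (cong (f x + g x +_) (∑-+ xs f g)) (lem (f x) (g x) _ _)
    where lem : ∀ a b c d → a + b + (c + d) ≡ a + c + (b + d)
          lem = solve-∀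

  ∑-*ˡ : ∀ xs c (f : A → ℕ) → ∑ xs (λ x → c * f x) ≡ c * ∑ xs f
  ∑-*ˡ []       c f = sym (*-zeroʳ c)
  ∑-*ˡ (x ∷ xs) c f = trans (cong (c * f x +_) (∑-*ˡ xs c f)) (sym (*-distribˡ-+ c (f x) _))

  ∑-*ʳ : ∀ xs c (f : A → ℕ) → ∑ xs (λ x → f x * c) ≡ ∑ xs f * c
  ∑-*ʳ []       c f = refl
  ∑-*ʳ (x ∷ xs) c f = trans (cong (f x * c +_) (∑-*ʳ xs c f)) (sym (*-distribʳ-+ c (f x) _))

  ∑-const : ∀ (xs : List A) c → ∑ xs (λ _ → c) ≡ length xs * c
  ∑-const []       c = refl
  ∑-const (x ∷ xs) c = cong (c +_) (∑-const xs c)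

  ∑-zero : ∀ (xs : List A) → ∑ xs (λ _ → 0) ≡ 0
  ∑-zero []       = refl
  ∑-zero (x ∷ xs) = ∑-zero xs

  ∑-++ : ∀ xs ys (f : A → ℕ) → ∑ (xs ++ ys) f ≡ ∑ xs f + ∑ ys f
  ∑-++ []       ys f = refl
  ∑-++ (x ∷ xs) ys f = trans (cong (f x +_) (∑-++ xs ys f)) (sym (+-assoc (f x) _ _))

∑-swap : ∀ {A B : Set} (xs : List A) (ys : List B) (f : A → B → ℕ) →
         ∑ xs (λ x → ∑ ys (f x)) ≡ ∑ ys (λ y → ∑ xs (λ x → f x y))
∑-swap []       ys f = sym (∑-zero ys)
∑-swap (x ∷ xs) ys f = trans (cong (∑ ys (f x) +_) (∑-swap xs ys f)) (sym (∑-+ ys (f x) _))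

∑-map : ∀ {A B : Set} (g : A → B) xs (f : B → ℕ) → ∑ (map g xs) f ≡ ∑ xs (f ∘ g)
∑-map g []       f = refl
∑-map g (x ∷ xs) f = cong (f (g x) +_) (∑-map g xs f)

-- Independent sets

module Independent {X : Set} (R : X → X → Bool) where

  infixl 6 _∩R_

  _∩R_ : (X → Bool) → X → X → Bool
  (P ∩R x) y = P y ∧ R x y

  -- `R` is non-adjacency, so `P ∩R x` discards the neighbours of x. The vertex set is cut down by a
  -- predicate, not by passing to sublists, so that a vertex anywhere in a fixed list can be
  -- deleted.
  indep : (X → Bool) → List X → ℕ
  indep P []       = 1
  indep P (x ∷ xs) = indep P xs + ⟦ P x ⟧ * indep (P ∩R x) xs

  count : (X → Bool) → List X → ℕ
  count P xs = ∑ xs (λ x → ⟦ P x ⟧)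

  indep-mono : ∀ {P Q} xs → (∀ x → x ∈ xs → ⟦ P x ⟧ ≤ ⟦ Q x ⟧) → indep P xs ≤ indep Q xs
  indep-mono         []       h = ≤-refl
  indep-mono {P} {Q} (x ∷ xs) h = +-mono-≤
    (indep-mono xs λ y y∈ → h y (there y∈))
    (*-mono-≤ (h x (here refl)) (indep-mono xs λ y y∈ →
      subst₂ _≤_ (sym (⟦∧⟧ (P y) _)) (sym (⟦∧⟧ (Q y) _)) (*-monoˡ-≤ ⟦ R x y ⟧ (h y (there y∈)))))

  indep≤2^count : ∀ P xs → indep P xs ≤ 2 ^ count P xs
  indep≤2^count P []       = ≤-refl
  indep≤2^count P (x ∷ xs) with P x
  ... | false = ≤-trans (≤-reflexive (+-identityʳ _)) (indep≤2^count P xs)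
  ... | true  = +-mono-≤ (indep≤2^count P xs) (*-monoʳ-≤ 1 (≤-trans
                  (indep-mono xs λ y _ → subst (_≤ ⟦ P y ⟧) (sym (⟦∧⟧ (P y) (R x y)))
                    (subst (⟦ P y ⟧ * ⟦ R x y ⟧ ≤_) (*-identityʳ _) (*-monoʳ-≤ ⟦ P y ⟧ (⟦⟧≤1 (R x y)))))
                  (indep≤2^count P xs)))

  2^count≤indep : ∀ P xs → Unique xs →
    (∀ x y → x ≢ y → P x ≡ true → P y ≡ true → R x y ≡ true) → 2 ^ count P xs ≤ indep P xs
  2^count≤indep P []       _        h = ≤-refl
  2^count≤indep P (x ∷ xs) (x∉ ∷ u) h with P x in Px
  ... | false = ≤-trans (2^count≤indep P xs u h) (m≤m+n _ _)
  ... | true  = +-mono-≤ (2^count≤indep P xs u h) (*-monoʳ-≤ 1 (≤-trans (2^count≤indep P xs u h)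
                  (indep-mono xs λ y y∈ → mono y (All.lookup x∉ y∈))))
    where
    mono : ∀ y → x ≢ y → ⟦ P y ⟧ ≤ ⟦ P y ∧ R x y ⟧
    mono y x≢y with P y in Py
    ... | false = z≤n
    ... | true  rewrite h x y x≢y Px Py = ≤-refl

  module Deletion (_≟_ : (x y : X) → Dec (x ≡ y)) (R-sym : ∀ x y → R x y ≡ R y x) where

    _∖_ : (X → Bool) → X → X → Bool
    (P ∖ v) y = P y ∧ not (does (y ≟ v))

    ∖-≢ : ∀ P {v y} → y ≢ v → (P ∖ v) y ≡ P y
    ∖-≢ P {v} {y} y≢v rewrite dec-false (y ≟ v) y≢v with P y
    ... | true  = refl
    ... | false = refl

    ∖-≡ : ∀ P v → (P ∖ v) v ≡ false
    ∖-≡ P v rewrite dec-true (v ≟ v) refl with P v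
    ... | true  = refl
    ... | false = refl

    -- The first term counts the independent sets that avoid v, the second those that contain it. As
    -- `indep` branches on the head of the list only, branching on an arbitrary v takes an
    -- induction.
    indep-delete : ∀ P v xs → Unique xs → indep P xs ≤ indep (P ∖ v) xs + indep (P ∩R v) xs
    indep-delete P v []       _        = s≤s z≤n
    indep-delete P v (y ∷ ys) (y∉ ∷ u) with y ≟ v
    ... | yes refl = begin
        indep P ys + ⟦ P v ⟧ * indep (P ∩R v) ys
          ≤⟨ +-mono-≤ (indep-mono ys λ z z∈ → ≤-reflexive (cong ⟦_⟧ (sym (∖-≢ P (All.lookup y∉ z∈ ∘ sym))))) (⟦⟧*≤ (P v) _) ⟩
        indep (P ∖ v) ys + indep (P ∩R v) ys
          ≤⟨ +-mono-≤ (m≤m+n (indep (P ∖ v) ys) _) (m≤m+n (indep (P ∩R v) ys) _) ⟩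
        _ ∎
      where open ≤-Reasoning
    ... | no y≢v with P y
    ...   | false = ≤-trans (≤-reflexive (+-identityʳ _)) (≤-trans (indep-delete P v ys u)
                      (≤-reflexive (sym (cong₂ _+_ (+-identityʳ (indep (P ∖ v) ys)) (+-identityʳ (indep (P ∩R v) ys))))))
    ...   | true  = begin
        indep P ys + (indep (P ∩R y) ys + 0)
          ≤⟨ +-mono-≤ (indep-delete P v ys u) (step (R v y) refl) ⟩
        indep (P ∖ v) ys + indep (P ∩R v) ys + (indep ((P ∖ v) ∩R y) ys + ⟦ R v y ⟧ * indep (P ∩R v ∩R y) ys)
          ≡⟨ lem (indep (P ∖ v) ys) (indep (P ∩R v) ys) _ _ ⟩
        _ ∎
      where
      open ≤-Reasoning
      lem : ∀ a b c d → a + b + (c + d) ≡ a + (c + 0) + (b + d)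
      lem = solve-∀
      swap : ∀ a b c → ⟦ (a ∧ b) ∧ c ⟧ ≤ ⟦ (a ∧ c) ∧ b ⟧
      swap false b     c     = z≤n
      swap true  false c     = z≤n
      swap true  true  true  = ≤-refl
      swap true  true  false = z≤n
      -- For adjacent y and v, the non-neighbours of y already exclude v, so every set containing y
      -- goes to the first term.
      avoid : R v y ≡ false → ∀ z → ⟦ P z ∧ R y z ⟧ ≤ ⟦ (P ∖ v) z ∧ R y z ⟧
      avoid Rvy z with z ≟ v
      ... | yes refl rewrite R-sym y z | Rvy with P z
      ...   | true  = z≤n
      ...   | false = z≤n
      avoid Rvy z | no z≢v with P z
      ...   | true  = ≤-refl
      ...   | false = z≤n
      -- For compatible y and v the induction hypothesis is applied among the non-neighbours of y,
      -- and the two restrictions are interchanged.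
      step : ∀ b → R v y ≡ b →
             indep (P ∩R y) ys + 0 ≤ indep ((P ∖ v) ∩R y) ys + ⟦ b ⟧ * indep (P ∩R v ∩R y) ys
      step true  Rvy = begin
        indep (P ∩R y) ys + 0
          ≡⟨ +-identityʳ _ ⟩
        indep (P ∩R y) ys
          ≤⟨ indep-delete (P ∩R y) v ys u ⟩
        indep ((P ∩R y) ∖ v) ys + indep (P ∩R y ∩R v) ys
          ≤⟨ +-mono-≤ (indep-mono ys λ z _ → swap (P z) (R y z) _)
               (≤-trans (indep-mono ys λ z _ → swap (P z) (R y z) _) (≤-reflexive (sym (+-identityʳ _)))) ⟩
        _ ∎
      step false Rvy = +-monoˡ-≤ 0 (indep-mono ys λ z _ → avoid Rvy z)

    count-∖ : ∀ P v xs → v ∈ xs → P v ≡ true → suc (count (P ∖ v) xs) ≤ count P xs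
    count-∖ P v (_ ∷ xs) (here refl) Pv rewrite ∖-≡ P v | Pv = s≤s (∑-mono xs λ y _ → drop y)
      where
      drop : ∀ y → ⟦ (P ∖ v) y ⟧ ≤ ⟦ P y ⟧
      drop y with P y
      ... | false = z≤n
      ... | true  = ⟦⟧≤1 _
    count-∖ P v (y ∷ xs) (there v∈) Pv =
      subst (_≤ count P (y ∷ xs)) (+-suc ⟦ (P ∖ v) y ⟧ _) (+-mono-≤ drop (count-∖ P v xs v∈ Pv))
      where
      drop : ⟦ (P ∖ v) y ⟧ ≤ ⟦ P y ⟧
      drop with P y
      ... | false = z≤n
      ... | true  = ⟦⟧≤1 _

    -- This is the number of vertices lost by putting v into the set. For `notTilted` it includes v
    -- itself, as no set is compatible with itself.
    degree : (X → Bool) → X → List X → ℕ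
    degree P v xs = count (λ y → P y ∧ not (R v y)) xs

    count-∩R : ∀ P v xs → count (P ∩R v) xs + degree P v xs ≡ count P xs
    count-∩R P v xs = trans (sym (∑-+ xs _ _)) (∑-cong xs λ y _ → split (P y) (R v y))
      where
      split : ∀ a b → ⟦ a ∧ b ⟧ + ⟦ a ∧ not b ⟧ ≡ ⟦ a ⟧
      split false b     = refl
      split true  true  = refl
      split true  false = refl

    -- The weight (b/a)^m of a set of m vertices pays for deleting one vertex (a factor 1 - 1/b) or
    -- e + 1 vertices (a factor (a/b)^(e+1) ≤ 1/b).
    indep-bound : ∀ xs a e M → Unique xs → suc a * a ^ suc e ≤ suc a ^ suc e →
      (∀ P → M < count P xs → ∃ λ v → v ∈ xs × P v ≡ true × suc e ≤ degree P v xs) →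
      ∀ P N → count P xs ≤ N → indep P xs * a ^ N ≤ 2 ^ M * suc a ^ N
    indep-bound xs a e M u key dense = λ P N → bound N N ≤-refl P
      where
      open ≤-Reasoning
      b = suc a
      small : ∀ P N → count P xs ≤ M → indep P xs * a ^ N ≤ 2 ^ M * b ^ N
      small P N c≤M = *-mono-≤ (≤-trans (indep≤2^count P xs) (^-monoʳ-≤ 2 c≤M)) (^-monoˡ-≤ N (n≤1+n a))
      -- K bounds the recursion: one branch lowers N by 1, the other by e + 1.
      bound : ∀ K N → N ≤ K → ∀ P → count P xs ≤ N → indep P xs * a ^ N ≤ 2 ^ M * b ^ N
      bound zero    N N≤K P c≤N = small P N (≤-trans (≤-trans c≤N N≤K) z≤n)
      bound (suc K) N N≤K P c≤N with count P xs ≤? M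
      ... | yes c≤M = small P N c≤M
      ... | no  c≰M with dense P (≰⇒> c≰M)
      ...   | v , v∈ , Pv , deg = begin
        indep P xs * a ^ N
          ≤⟨ *-monoˡ-≤ (a ^ N) (indep-delete P v xs u) ⟩
        (i₁ + i₂) * a ^ N
          ≡⟨ *-distribʳ-+ (a ^ N) i₁ i₂ ⟩
        i₁ * a ^ N + i₂ * a ^ N
          ≤⟨ +-mono-≤ first second ⟩
        a * W + W
          ≡⟨ lem a (2 ^ M) (b ^ N') ⟩
        2 ^ M * (b * b ^ N')
          ≡⟨ cong (λ z → 2 ^ M * b ^ z) (sym N≡) ⟩
        2 ^ M * b ^ N ∎
        where
        i₁ = indep (P ∖ v) xs
        i₂ = indep (P ∩R v) xs
        N' = pred N
        W = 2 ^ M * b ^ N'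
        e<N : suc e ≤ N
        e<N = ≤-trans deg (≤-trans (m≤n+m _ _) (≤-trans (≤-reflexive (count-∩R P v xs)) c≤N))
        N≡ : N ≡ suc N'
        N≡ = sym (suc-pred N {{>-nonZero (≤-trans (s≤s z≤n) e<N)}})
        N'≤K : N' ≤ K
        N'≤K = s≤s⁻¹ (subst (_≤ suc K) N≡ N≤K)
        lem : ∀ a x y → a * (x * y) + x * y ≡ x * (suc a * y)
        lem = solve-∀
        first : i₁ * a ^ N ≤ a * W
        first = begin
          i₁ * a ^ N           ≡⟨ cong (λ z → i₁ * a ^ z) N≡ ⟩
          i₁ * (a * a ^ N')    ≡⟨ x∙yz≈y∙xz i₁ a _ ⟩
          a * (i₁ * a ^ N')
            ≤⟨ *-monoʳ-≤ a (bound K N' N'≤K (P ∖ v)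
                 (s≤s⁻¹ (≤-trans (count-∖ P v xs v∈ Pv) (subst (count P xs ≤_) N≡ c≤N)))) ⟩
          a * W ∎
        N″ = N ∸ suc e
        N″≡ : suc e + N″ ≡ N
        N″≡ = m+[n∸m]≡n e<N
        c₂ : count (P ∩R v) xs ≤ N″
        c₂ = +-cancelʳ-≤ (suc e) _ _ (begin
          count (P ∩R v) xs + suc e         ≤⟨ +-monoʳ-≤ _ deg ⟩
          count (P ∩R v) xs + degree P v xs ≡⟨ count-∩R P v xs ⟩
          count P xs                        ≤⟨ c≤N ⟩
          N                                 ≡⟨ N″≡ ⟨
          suc e + N″                        ≡⟨ +-comm (suc e) N″ ⟩
          N″ + suc e ∎)
        N″≤K : N″ ≤ K
        N″≤K = s≤s⁻¹ (≤-trans (m+n≤o⇒n≤o e (≤-reflexive (trans (+-suc e N″) N″≡))) N≤K)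
        second : i₂ * a ^ N ≤ W
        second = *-cancelˡ-≤ b (begin
          b * (i₂ * a ^ N)                     ≡⟨ cong (λ z → b * (i₂ * z)) (trans (cong (a ^_) (sym N″≡)) (^-distribˡ-+-* a (suc e) N″)) ⟩
          b * (i₂ * (a ^ suc e * a ^ N″))      ≡⟨ rearrange b i₂ (a ^ suc e) (a ^ N″) ⟩
          (b * a ^ suc e) * (i₂ * a ^ N″)      ≤⟨ *-mono-≤ key (bound K N″ N″≤K (P ∩R v) c₂) ⟩
          b ^ suc e * (2 ^ M * b ^ N″)         ≡⟨ x∙yz≈y∙xz (b ^ suc e) (2 ^ M) (b ^ N″) ⟩
          2 ^ M * (b ^ suc e * b ^ N″)         ≡⟨ cong (2 ^ M *_) (trans (sym (^-distribˡ-+-* b (suc e) N″)) (cong (b ^_) (trans N″≡ N≡))) ⟩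
          2 ^ M * (b * b ^ N')                 ≡⟨ x∙yz≈y∙xz (2 ^ M) b (b ^ N') ⟩
          b * W ∎)
          where
          rearrange : ∀ b i x y → b * (i * (x * y)) ≡ (b * x) * (i * y)
          rearrange = solve-∀

-- Orderings of a list and the words they induce

module _ {A : Set} where

  select : List A → List (A × List A)
  select []       = []
  select (x ∷ xs) = (x , xs) ∷ map (λ s → proj₁ s , x ∷ proj₂ s) (select xs)

  -- With a list of n positions, the vector is indexed by the ground set and its entry at x is the
  -- position of x. Thus `Vec.map φ u` is the set of elements whose position satisfies φ, and
  -- counting can recurse along the coordinates of a subset.
  orderings : ∀ n → List A → List (Vec A n)
  orderings zero    L = [ [] ]
  orderings (suc n) L = concatMap (λ s → map (proj₁ s ∷_) (orderings n (proj₂ s))) (select L)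

  cnt : (A → Bool) → List A → ℕ
  cnt φ L = ∑ L (λ x → ⟦ φ x ⟧)

  cnt-not : ∀ φ L → cnt φ L + cnt (not ∘ φ) L ≡ length L
  cnt-not φ []      = refl
  cnt-not φ (x ∷ L) with φ x
  ... | true  = cong suc (cnt-not φ L)
  ... | false = trans (+-suc _ _) (cong suc (cnt-not φ L))

  ∑-select : ∀ L (g : A → ℕ) → ∑ (select L) (g ∘ proj₁) ≡ ∑ L g
  ∑-select []      g = refl
  ∑-select (x ∷ L) g = cong (g x +_) (trans (∑-map _ (select L) _) (∑-select L g))

  cnt-select : ∀ φ L {s} → s ∈ select L → cnt φ L ≡ ⟦ φ (proj₁ s) ⟧ + cnt φ (proj₂ s)
  cnt-select φ (x ∷ L) (here refl) = refl
  cnt-select φ (x ∷ L) (there s∈) with ∈-map⁻ _ s∈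
  ... | s′ , s′∈ , refl = trans (cong (⟦ φ x ⟧ +_) (cnt-select φ L s′∈)) (lem ⟦ φ x ⟧ ⟦ φ (proj₁ s′) ⟧ _)
    where lem : ∀ a b c → a + (b + c) ≡ b + (a + c)
          lem = solve-∀

  ∑-orderings : ∀ n L (f : Vec A (suc n) → ℕ) →
    ∑ (orderings (suc n) L) f ≡ ∑ (select L) (λ s → ∑ (orderings n (proj₂ s)) (λ u → f (proj₁ s ∷ u)))
  ∑-orderings n L f = go (select L)
    where
    go : ∀ ss → ∑ (concatMap (λ s → map (proj₁ s ∷_) (orderings n (proj₂ s))) ss) f
              ≡ ∑ ss (λ s → ∑ (orderings n (proj₂ s)) (λ u → f (proj₁ s ∷ u)))
    go []       = refl
    go (s ∷ ss) = trans (∑-++ (map (proj₁ s ∷_) (orderings n (proj₂ s))) _ f)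
                        (cong₂ _+_ (∑-map (proj₁ s ∷_) (orderings n (proj₂ s)) f) (go ss))

  -- Whichever entry satisfying φ comes first, the remaining entries contribute the same κ. Counts
  -- of orderings thus become products that depend on how many entries carry each label, not on
  -- which ones do.
  ∑-orderings-head : ∀ n L φ κ (g : Vec A n → ℕ) {f} → (∀ x u → f (x ∷ u) ≡ ⟦ φ x ⟧ * g u) →
    (∀ s → s ∈ select L → φ (proj₁ s) ≡ true → ∑ (orderings n (proj₂ s)) g ≡ κ) →
    ∑ (orderings (suc n) L) f ≡ cnt φ L * κ
  ∑-orderings-head n L φ κ g {f} f≡ tails = begin
    ∑ (orderings (suc n) L) f
      ≡⟨ ∑-orderings n L f ⟩
    ∑ (select L) (λ s → ∑ (orderings n (proj₂ s)) (λ u → f (proj₁ s ∷ u)))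
      ≡⟨ ∑-cong (select L) (λ s s∈ → trans (∑-cong (orderings n (proj₂ s)) (λ u _ → f≡ (proj₁ s) u))
           (trans (∑-*ˡ (orderings n (proj₂ s)) ⟦ φ (proj₁ s) ⟧ g) (tail s s∈))) ⟩
    ∑ (select L) (λ s → ⟦ φ (proj₁ s) ⟧ * κ)
      ≡⟨ ∑-*ʳ (select L) κ _ ⟩
    ∑ (select L) (λ s → ⟦ φ (proj₁ s) ⟧) * κ
      ≡⟨ cong (_* κ) (∑-select L (λ x → ⟦ φ x ⟧)) ⟩
    cnt φ L * κ ∎
    where
    open ≡-Reasoning
    tail : ∀ s → s ∈ select L → ⟦ φ (proj₁ s) ⟧ * ∑ (orderings n (proj₂ s)) g ≡ ⟦ φ (proj₁ s) ⟧ * κ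
    tail s s∈ with φ (proj₁ s) in φs
    ... | true  = cong (1 *_) (tails s s∈ φs)
    ... | false = refl

  length-select : ∀ L {s} → s ∈ select L → length L ≡ suc (length (proj₂ s))
  length-select (x ∷ L) (here refl) = refl
  length-select (x ∷ L) (there s∈) with ∈-map⁻ _ s∈
  ... | s′ , s′∈ , refl = cong suc (length-select L s′∈)

  ∑-orderings-1 : ∀ n L → length L ≡ n → ∑ (orderings n L) (λ _ → 1) ≡ n !
  ∑-orderings-1 zero    L len = refl
  ∑-orderings-1 (suc n) L len = trans
    (∑-orderings-head n L (λ _ → true) (n !) (λ _ → 1) (λ _ _ → refl)
      (λ s s∈ _ → ∑-orderings-1 n (proj₂ s) (suc-injective (trans (sym (length-select L s∈)) len))))
    (cong (_* n !) (trans (∑-const L 1) (trans (*-identityʳ _) len)))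

  -- An ordering uses each entry of the list exactly once, so the size of the set read off is the
  -- same for all orderings.
  ∣map∣ : ∀ (φ : A → Bool) n L {u} → length L ≡ n → u ∈ orderings n L → ∣ Vec.map φ u ∣ ≡ cnt φ L
  ∣map∣ φ zero    []      len (here refl) = refl
  ∣map∣ φ (suc n) L       len u∈ with ∈-concatMap⁻ (λ s → map (proj₁ s ∷_) (orderings n (proj₂ s))) {xs = select L} u∈
  ... | ss with find ss
  ...   | s , s∈ , u∈′ with ∈-map⁻ (proj₁ s ∷_) u∈′
  ...     | u′ , u′∈ , refl = trans (head (φ (proj₁ s)) (Vec.map φ u′)) (trans
              (cong (⟦ φ (proj₁ s) ⟧ +_) (∣map∣ φ n (proj₂ s) (suc-injective (trans (sym (length-select L s∈)) len)) u′∈))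
              (sym (cnt-select φ L s∈)))
    where
    head : ∀ {n} b (B : Subset n) → ∣ b ∷ B ∣ ≡ ⟦ b ⟧ + ∣ B ∣
    head true  B = refl
    head false B = refl

-- Counting orderings by the words they spell

infix 4 _==_

-- The second argument keeps its head as a variable: comparison with `Vec.map φ u` then yields a
-- factor `φ x`, the form that `∑-orderings-head` asks for.
_==_ : ∀ {n} → Subset n → Subset n → Bool
[]          == []      = true
(true  ∷ A) == (b ∷ B) = b ∧ (A == B)
(false ∷ A) == (b ∷ B) = not b ∧ (A == B)

==⇒≡ : ∀ {n} (A B : Subset n) → (A == B) ≡ true → A ≡ B
==⇒≡ []          []          _ = refl
==⇒≡ (true ∷ A)  (true ∷ B)  e = cong (true ∷_) (==⇒≡ A B e)
==⇒≡ (false ∷ A) (false ∷ B) e = cong (false ∷_) (==⇒≡ A B e)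

∑-== : ∀ n (B : Subset n) (f : Subset n → ℕ) → ∑ (allSubsets n) (λ A → ⟦ A == B ⟧ * f A) ≡ f B
∑-== zero    []      f = trans (+-identityʳ _) (+-identityʳ _)
∑-== (suc n) (b ∷ B) f = trans (∑-++ (map (true ∷_) (allSubsets n)) _ _)
  (trans (cong₂ _+_ (∑-map (true ∷_) (allSubsets n) _) (∑-map (false ∷_) (allSubsets n) _)) (go b))
  where
  go : ∀ b → ∑ (allSubsets n) (λ A → ⟦ (true ∷ A) == (b ∷ B) ⟧ * f (true ∷ A))
           + ∑ (allSubsets n) (λ A → ⟦ (false ∷ A) == (b ∷ B) ⟧ * f (false ∷ A)) ≡ f (b ∷ B)
  go true  = trans (cong₂ _+_ (∑-== n B (f ∘ (true ∷_))) (∑-zero (allSubsets n))) (+-identityʳ _)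
  go false = cong₂ _+_ (∑-zero (allSubsets n)) (∑-== n B (f ∘ (false ∷_)))

-- The number of orderings of t elements labelled true and f elements labelled false whose
-- labels spell A, and its analogue for pairs of labels.
words₁ : ∀ {n} → ℕ → ℕ → Subset n → ℕ
words₁ t f []          = 1
words₁ t f (true ∷ A)  = t * words₁ (pred t) f A
words₁ t f (false ∷ A) = f * words₁ t (pred f) A

words₂ : ∀ {n} → ℕ → ℕ → ℕ → ℕ → Subset n → Subset n → ℕ
words₂ tt tf ft ff []          []          = 1
words₂ tt tf ft ff (true ∷ A)  (true ∷ B)  = tt * words₂ (pred tt) tf ft ff A B
words₂ tt tf ft ff (true ∷ A)  (false ∷ B) = tf * words₂ tt (pred tf) ft ff A B
words₂ tt tf ft ff (false ∷ A) (true ∷ B)  = ft * words₂ tt tf (pred ft) ff A B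
words₂ tt tf ft ff (false ∷ A) (false ∷ B) = ff * words₂ tt tf ft (pred ff) A B

words₁-value : ∀ {n} (A : Subset n) t f → t + f ≡ n → ∣ A ∣ ≡ t → words₁ t f A ≡ t ! * f !
words₁-value []          zero    zero    e refl = refl
words₁-value (true ∷ A)  (suc t) f       e a = trans
  (cong (suc t *_) (words₁-value A t f (suc-injective e) (suc-injective a))) (sym (*-assoc (suc t) (t !) (f !)))
words₁-value (false ∷ A) t       zero    e a = ⊥-elim (<⇒≱ (s≤s (∣p∣≤n A)) (≤-reflexive
  (trans (sym e) (trans (+-identityʳ t) (sym a)))))
words₁-value (false ∷ A) t       (suc f) e a = trans
  (cong (suc f *_) (words₁-value A t f (suc-injective (trans (sym (+-suc t f)) e)) a)) (x∙yz≈y∙xz (suc f) (t !) (f !))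

-- Forgetting the second labels merges two label classes, which can only enlarge the choice at each
-- coordinate.
words₂≤words₁ : ∀ {n} (A B : Subset n) tt tf ft ff → words₂ tt tf ft ff A B ≤ words₁ (tt + tf) (ft + ff) A
words₂≤words₁ []          []          tt tf ft ff = ≤-refl
words₂≤words₁ (true ∷ A)  (true ∷ B)  zero     tf ft ff = z≤n
words₂≤words₁ (true ∷ A)  (true ∷ B)  (suc tt) tf ft ff =
  *-mono-≤ (m≤m+n (suc tt) tf) (words₂≤words₁ A B tt tf ft ff)
words₂≤words₁ (true ∷ A)  (false ∷ B) tt zero     ft ff = z≤n
words₂≤words₁ (true ∷ A)  (false ∷ B) tt (suc tf) ft ff rewrite +-suc tt tf =
  *-mono-≤ (s≤s (m≤n+m tf tt)) (words₂≤words₁ A B tt tf ft ff)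
words₂≤words₁ (false ∷ A) (true ∷ B)  tt tf zero     ff = z≤n
words₂≤words₁ (false ∷ A) (true ∷ B)  tt tf (suc ft) ff =
  *-mono-≤ (m≤m+n (suc ft) ff) (words₂≤words₁ A B tt tf ft ff)
words₂≤words₁ (false ∷ A) (false ∷ B) tt tf ft zero     = z≤n
words₂≤words₁ (false ∷ A) (false ∷ B) tt tf ft (suc ff) rewrite +-suc ft ff =
  *-mono-≤ (s≤s (m≤n+m ff ft)) (words₂≤words₁ A B tt tf ft ff)

-- Given the first labels, an element of second label true could trade places with any of the
-- elements labelled (false , false).
words₂-gap : ∀ {n} (A B : Subset n) tt tf ft ff → tt + tf + (suc ft + ff) ≡ n →
  suc ff * words₂ tt tf (suc ft) ff A B ≤ words₁ (tt + tf) (suc ft + ff) A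
words₂-gap []          []          tt tf ft ff e = ⊥-elim (1+n≢0 (trans (sym (+-suc (tt + tf) _)) e))
words₂-gap (true ∷ A)  (true ∷ B)  zero     tf ft ff e = ≤-trans (≤-reflexive (*-zeroʳ ff)) z≤n
words₂-gap (true ∷ A)  (true ∷ B)  (suc tt) tf ft ff e = ≤-trans
  (≤-reflexive (x∙yz≈y∙xz (suc ff) (suc tt) _))
  (*-mono-≤ (m≤m+n (suc tt) tf) (words₂-gap A B tt tf ft ff (suc-injective e)))
words₂-gap (true ∷ A)  (false ∷ B) tt zero     ft ff e = ≤-trans (≤-reflexive (*-zeroʳ ff)) z≤n
words₂-gap (true ∷ A)  (false ∷ B) tt (suc tf) ft ff e rewrite +-suc tt tf = ≤-trans
  (≤-reflexive (x∙yz≈y∙xz (suc ff) (suc tf) _))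
  (*-mono-≤ (s≤s (m≤n+m tf tt)) (words₂-gap A B tt tf ft ff (suc-injective e)))
-- The last element labelled (false , true) is placed here. The first word alone leaves `suc ff`
-- candidates for this coordinate, which pays for the whole factor.
words₂-gap (false ∷ A) (true ∷ B)  tt tf zero     ff e = *-monoʳ-≤ (suc ff)
  (≤-trans (≤-reflexive (+-identityʳ _)) (words₂≤words₁ A B tt tf 0 ff))
words₂-gap (false ∷ A) (true ∷ B)  tt tf (suc ft) ff e = ≤-trans
  (≤-reflexive (x∙yz≈y∙xz (suc ff) (suc (suc ft)) (words₂ tt tf (suc ft) ff A B)))
  (*-mono-≤ (m≤m+n (suc (suc ft)) ff) (words₂-gap A B tt tf ft ff
    (suc-injective (trans (sym (+-suc (tt + tf) _)) e))))
words₂-gap (false ∷ A) (false ∷ B) tt tf ft zero     e = z≤n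
-- The factors change roles: the extra factor is matched with the choice at this coordinate, and the
-- choice `suc ff` becomes the extra factor of the induction hypothesis.
words₂-gap (false ∷ A) (false ∷ B) tt tf ft (suc ff) e rewrite +-suc ft ff =
  *-mono-≤ (s≤s (s≤s (m≤n+m ff ft))) (words₂-gap A B tt tf ft ff
    (suc-injective (trans (sym (+-suc (tt + tf) _)) e)))

module _ {A : Set} (φ : A → Bool) where

  private
    pred-cnt : ∀ (χ : A → Bool) L {s} → s ∈ select L → χ (proj₁ s) ≡ true → cnt χ (proj₂ s) ≡ pred (cnt χ L)
    pred-cnt χ L {s} s∈ χs =
      sym (cong pred (trans (cnt-select χ L s∈) (cong (λ b → ⟦ b ⟧ + cnt χ (proj₂ s)) χs)))

    same-cnt : ∀ (χ : A → Bool) L {s} → s ∈ select L → χ (proj₁ s) ≡ false → cnt χ (proj₂ s) ≡ cnt χ L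
    same-cnt χ L {s} s∈ χs = sym (trans (cnt-select χ L s∈) (cong (λ b → ⟦ b ⟧ + cnt χ (proj₂ s)) χs))

  count-words₁ : ∀ {n} (B : Subset n) L →
    ∑ (orderings n L) (λ u → ⟦ B == Vec.map φ u ⟧) ≡ words₁ (cnt φ L) (cnt (not ∘ φ) L) B
  count-words₁ []          L = refl
  count-words₁ (true ∷ B)  L = ∑-orderings-head _ L φ _ _ (λ x u → ⟦∧⟧ (φ x) _)
    λ s s∈ φs → trans (count-words₁ B (proj₂ s)) (cong₂ (λ x y → words₁ x y B)
      (pred-cnt φ L s∈ φs) (same-cnt (not ∘ φ) L s∈ (cong not φs)))
  count-words₁ (false ∷ B) L = ∑-orderings-head _ L (not ∘ φ) _ _ (λ x u → ⟦∧⟧ (not (φ x)) _)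
    λ s s∈ φs → trans (count-words₁ B (proj₂ s)) (cong₂ (λ x y → words₁ x y B)
      (same-cnt φ L s∈ (not-true φs)) (pred-cnt (not ∘ φ) L s∈ φs))
    where not-true : ∀ {b} → not b ≡ true → b ≡ false
          not-true {false} _ = refl

module _ {A : Set} (φ ψ : A → Bool) where

  is : Bool → Bool → Bool
  is true  y = y
  is false y = not y

  labels : Bool → Bool → A → Bool
  labels a b x = is a (φ x) ∧ is b (ψ x)

  private
    recover : ∀ a b {y z} → is a y ∧ is b z ≡ true → y ≡ a × z ≡ b
    recover true  true  {true}  {true}  _ = refl , refl
    recover true  false {true}  {false} _ = refl , refl
    recover false true  {false} {true}  _ = refl , refl
    recover false false {false} {false} _ = refl , refl

    split : ∀ y z c d → ⟦ y ∧ c ⟧ * ⟦ z ∧ d ⟧ ≡ ⟦ y ∧ z ⟧ * (⟦ c ⟧ * ⟦ d ⟧)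
    split true  true  c d = sym (+-identityʳ _)
    split true  false c d = *-zeroʳ ⟦ c ⟧
    split false z     c d = refl

    cnt-after : ∀ a b L {s} → s ∈ select L → labels a b (proj₁ s) ≡ true → ∀ a′ b′ →
      cnt (labels a′ b′) L ≡ ⟦ is a′ a ∧ is b′ b ⟧ + cnt (labels a′ b′) (proj₂ s)
    cnt-after a b L {s} s∈ e a′ b′ with recover a b e
    ... | eφ , eψ = trans (cnt-select _ L s∈) (cong (λ z → ⟦ z ⟧ + cnt (labels a′ b′) (proj₂ s)) (cong₂ (λ y z → is a′ y ∧ is b′ z) eφ eψ))

  pair-words : ∀ {n} → List A → Subset n → Subset n → ℕ
  pair-words L = words₂ (cnt (labels true true) L) (cnt (labels true false) L)
                        (cnt (labels false true) L) (cnt (labels false false) L)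

  count-words₂ : ∀ {n} (B D : Subset n) L →
    ∑ (orderings n L) (λ u → ⟦ B == Vec.map φ u ⟧ * ⟦ D == Vec.map ψ u ⟧) ≡ pair-words L B D
  count-words₂ []      []      L = refl
  count-words₂ (a ∷ B) (b ∷ D) L = trans
    (∑-orderings-head _ L (labels a b) (rest a b) _
      (λ x u → trans (cong₂ (λ y z → ⟦ y ⟧ * ⟦ z ⟧) (head a B) (head b D)) (split (is a (φ x)) (is b (ψ x)) _ _))
      λ s s∈ e → trans (count-words₂ B D (proj₂ s)) (tail a b s s∈ e))
    (step a b)
    where
    head : ∀ {n} a (B : Subset n) {y E} → ((a ∷ B) == (y ∷ E)) ≡ is a y ∧ (B == E)
    head true  B = refl
    head false B = refl
    c : Bool → Bool → ℕ
    c a b = cnt (labels a b) L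
    rest : Bool → Bool → ℕ
    rest true  true  = words₂ (pred (c true true)) (c true false) (c false true) (c false false) B D
    rest true  false = words₂ (c true true) (pred (c true false)) (c false true) (c false false) B D
    rest false true  = words₂ (c true true) (c true false) (pred (c false true)) (c false false) B D
    rest false false = words₂ (c true true) (c true false) (c false true) (pred (c false false)) B D
    step : ∀ a b → c a b * rest a b ≡ pair-words L (a ∷ B) (b ∷ D)
    step true  true  = refl
    step true  false = refl
    step false true  = refl
    step false false = refl
    tail : ∀ a b s → s ∈ select L → labels a b (proj₁ s) ≡ true → pair-words (proj₂ s) B D ≡ rest a b
    tail true  true  s s∈ e rewrite cnt-after true true L s∈ e true true | cnt-after true true L s∈ e true false
      | cnt-after true true L s∈ e false true | cnt-after true true L s∈ e false false = refl
    tail true  false s s∈ e rewrite cnt-after true false L s∈ e true true | cnt-after true false L s∈ e true false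
      | cnt-after true false L s∈ e false true | cnt-after true false L s∈ e false false = refl
    tail false true  s s∈ e rewrite cnt-after false true L s∈ e true true | cnt-after false true L s∈ e true false
      | cnt-after false true L s∈ e false true | cnt-after false true L s∈ e false false = refl
    tail false false s s∈ e rewrite cnt-after false false L s∈ e true true | cnt-after false false L s∈ e true false
      | cnt-after false false L s∈ e false true | cnt-after false false L s∈ e false false = refl

-- Tilted chains

map-─ : ∀ {A : Set} {n} (φ ψ : A → Bool) (u : Vec A n) →
  Vec.map φ u ─ Vec.map ψ u ≡ Vec.map (labels φ ψ true false) u
map-─ φ ψ []      = refl
map-─ φ ψ (x ∷ u) with φ x | ψ x
... | true  | true  = cong (false ∷_) (map-─ φ ψ u)
... | true  | false = cong (true ∷_) (map-─ φ ψ u)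
... | false | true  = cong (false ∷_) (map-─ φ ψ u)
... | false | false = cong (false ∷_) (map-─ φ ψ u)

interval : ℕ → ℕ → ℕ → Bool
interval α γ x = not (x <ᵇ α) ∧ (x <ᵇ γ)

<ᵇ-true : ∀ {x y} → x < y → (x <ᵇ y) ≡ true
<ᵇ-true {x} {y} x<y with x <ᵇ y in e
... | true  = refl
... | false = ⊥-elim (subst T e (<⇒<ᵇ x<y))

<ᵇ-mono : ∀ {x y z} → y ≤ z → (x <ᵇ y) ≡ true → (x <ᵇ z) ≡ true
<ᵇ-mono {x} {y} y≤z e = <ᵇ-true (<-≤-trans (<ᵇ⇒< x y (subst T (sym e) _)) y≤z)

cnt-below : ∀ n h → cnt (_<ᵇ h) (downFrom n) ≡ n ⊓ h
cnt-below zero    h = refl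
cnt-below (suc n) h with n <ᵇ h in e
... | true  = trans (cong suc (trans (cnt-below n h) (m≤n⇒m⊓n≡m (<⇒≤ n<h)))) (sym (m≤n⇒m⊓n≡m n<h))
  where n<h = <ᵇ⇒< n h (subst T (sym e) _)
... | false = trans (cnt-below n h) (trans (m≥n⇒m⊓n≡n h≤n) (sym (m≥n⇒m⊓n≡n (≤-trans h≤n (n≤1+n n)))))
  where h≤n = ≮⇒≥ λ n<h → ⊥-elim (subst T e (<⇒<ᵇ n<h))

cnt-interval : ∀ n {α γ} → α ≤ γ → γ ≤ n → cnt (interval α γ) (downFrom n) + α ≡ γ
cnt-interval n {α} {γ} α≤γ γ≤n = begin
  cnt (interval α γ) (downFrom n) + α
    ≡⟨ cong (cnt (interval α γ) (downFrom n) +_) (trans (sym (m≥n⇒m⊓n≡n (≤-trans α≤γ γ≤n))) (sym (cnt-below n α))) ⟩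
  cnt (interval α γ) (downFrom n) + cnt (_<ᵇ α) (downFrom n)
    ≡⟨ ∑-+ (downFrom n) _ _ ⟨
  ∑ (downFrom n) (λ x → ⟦ interval α γ x ⟧ + ⟦ x <ᵇ α ⟧)
    ≡⟨ ∑-cong (downFrom n) (λ x _ → split (x <ᵇ α) (x <ᵇ γ) (<ᵇ-mono {x} α≤γ)) ⟩
  cnt (_<ᵇ γ) (downFrom n)
    ≡⟨ trans (cnt-below n γ) (m≥n⇒m⊓n≡n γ≤n) ⟩
  γ ∎
  where
  open ≡-Reasoning
  split : ∀ a c → (a ≡ true → c ≡ true) → ⟦ not a ∧ c ⟧ + ⟦ a ⟧ ≡ ⟦ c ⟧
  split true  c h = cong ⟦_⟧ (sym (h refl))
  split false c h = +-identityʳ _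

module _ {A : Set} (φ ψ : A → Bool) where

  cnt-labels : ∀ a L → cnt (labels φ ψ a true) L + cnt (labels φ ψ a false) L ≡ cnt (is φ ψ a ∘ φ) L
  cnt-labels a L = trans (sym (∑-+ L _ _)) (∑-cong L λ x _ → split (is φ ψ a (φ x)) (ψ x))
    where
    split : ∀ y z → ⟦ y ∧ z ⟧ + ⟦ y ∧ not z ⟧ ≡ ⟦ y ⟧
    split false z     = refl
    split true  true  = refl
    split true  false = refl

  -- In terms of probability: given that the first set of a random ordering is B, the second one is
  -- D with probability at most 1/(ff + 1), where ff is the number of positions outside both
  -- windows.
  count-pair-gap : ∀ {n} (B D : Subset n) L → length L ≡ n → 1 ≤ cnt (labels φ ψ false true) L →
    suc (cnt (labels φ ψ false false) L) * ∑ (orderings n L) (λ u → ⟦ B == Vec.map φ u ⟧ * ⟦ D == Vec.map ψ u ⟧)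
      ≤ ∑ (orderings n L) (λ u → ⟦ B == Vec.map φ u ⟧)
  count-pair-gap {n} B D L len 1≤ft = begin
    suc ff * ∑ (orderings n L) (λ u → ⟦ B == Vec.map φ u ⟧ * ⟦ D == Vec.map ψ u ⟧)
      ≡⟨ cong (suc ff *_) (count-words₂ φ ψ B D L) ⟩
    suc ff * words₂ tt tf ft ff B D
      ≡⟨ cong (λ z → suc ff * words₂ tt tf z ff B D) ft≡ ⟨
    suc ff * words₂ tt tf (suc (pred ft)) ff B D
      ≤⟨ words₂-gap B D tt tf (pred ft) ff (trans (cong (λ z → tt + tf + (z + ff)) ft≡)
           (trans (cong₂ _+_ (cnt-labels true L) (cnt-labels false L)) (trans (cnt-not φ L) len))) ⟩
    words₁ (tt + tf) (suc (pred ft) + ff) B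
      ≡⟨ cong₂ (λ y z → words₁ y z B) (cnt-labels true L) (trans (cong (_+ ff) ft≡) (cnt-labels false L)) ⟩
    words₁ (cnt φ L) (cnt (not ∘ φ) L) B
      ≡⟨ count-words₁ φ B L ⟨
    ∑ (orderings n L) (λ u → ⟦ B == Vec.map φ u ⟧) ∎
    where
    open ≤-Reasoning
    tt = cnt (labels φ ψ true true) L
    tf = cnt (labels φ ψ true false) L
    ft = cnt (labels φ ψ false true) L
    ff = cnt (labels φ ψ false false) L
    ft≡ : suc (pred ft) ≡ ft
    ft≡ = suc-pred ft {{>-nonZero 1≤ft}}

module _ {α β γ δ} (α≤β : α ≤ β) (β≤γ : β ≤ γ) (γ≤δ : γ ≤ δ) where

  private
    -- The thresholds cut the line into five stretches, so an identity about the windows from α to γ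
    -- and from β to δ has to be checked on five of the sixteen comparison patterns only.
    implications : ∀ {P : Bool → Bool → Bool → Bool → Set} →
      P true true true true → P false true true true → P false false true true →
      P false false false true → P false false false false →
      ∀ x → P (x <ᵇ α) (x <ᵇ β) (x <ᵇ γ) (x <ᵇ δ)
    implications p₁ p₂ p₃ p₄ p₅ x with x <ᵇ α in a | x <ᵇ β in b | x <ᵇ γ in c | x <ᵇ δ in d
    ... | true  | true  | true  | true  = p₁
    ... | false | true  | true  | true  = p₂
    ... | false | false | true  | true  = p₃
    ... | false | false | false | true  = p₄
    ... | false | false | false | false = p₅
    ... | true  | false | _     | _     with () ← trans (sym b) (<ᵇ-mono {x} α≤β a)
    ... | _     | true  | false | _     with () ← trans (sym c) (<ᵇ-mono {x} β≤γ b)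
    ... | _     | _     | true  | false with () ← trans (sym d) (<ᵇ-mono {x} γ≤δ c)

  private
    φ = interval α γ
    ψ = interval β δ

  cnt-removed : ∀ n → γ ≤ n → cnt (labels φ ψ true false) (downFrom n) + α ≡ β
  cnt-removed n γ≤n = trans (cong (_+ α) (∑-cong (downFrom n) λ x _ → implications
    {P = λ a b c d → ⟦ (not a ∧ c) ∧ not (not b ∧ d) ⟧ ≡ ⟦ not a ∧ b ⟧} refl refl refl refl refl x))
    (cnt-interval n α≤β (≤-trans β≤γ γ≤n))

  cnt-added : ∀ n → δ ≤ n → cnt (labels φ ψ false true) (downFrom n) + γ ≡ δ
  cnt-added n δ≤n = trans (cong (_+ γ) (∑-cong (downFrom n) λ x _ → implications
    {P = λ a b c d → ⟦ not (not a ∧ c) ∧ (not b ∧ d) ⟧ ≡ ⟦ not c ∧ d ⟧} refl refl refl refl refl x))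
    (cnt-interval n γ≤δ δ≤n)

  cnt-outside : ∀ n → δ ≤ n → n ≤ cnt (labels φ ψ false false) (downFrom n) + δ
  cnt-outside n δ≤n = begin
    n                                                      ≡⟨ length-downFrom n ⟨
    length (downFrom n)                                    ≡⟨ cnt-not (_<ᵇ δ) (downFrom n) ⟨
    cnt (_<ᵇ δ) (downFrom n) + cnt (not ∘ (_<ᵇ δ)) (downFrom n)
      ≡⟨ +-comm (cnt (_<ᵇ δ) (downFrom n)) _ ⟩
    cnt (not ∘ (_<ᵇ δ)) (downFrom n) + cnt (_<ᵇ δ) (downFrom n)
      ≤⟨ +-mono-≤ (∑-mono (downFrom n) λ x _ → implications
           {P = λ a b c d → ⟦ not d ⟧ ≤ ⟦ not (not a ∧ c) ∧ not (not b ∧ d) ⟧} z≤n z≤n z≤n z≤n ≤-refl x)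
           (≤-reflexive (trans (cnt-below n δ) (m≥n⇒m⊓n≡n δ≤n))) ⟩
    cnt (labels φ ψ false false) (downFrom n) + δ ∎
    where open ≤-Reasoning

∑-downFrom-mono : ∀ {j J} (f : ℕ → ℕ) → j ≤ J → ∑ (downFrom j) f ≤ ∑ (downFrom J) f
∑-downFrom-mono {J = zero}  f z≤n = ≤-refl
∑-downFrom-mono {j} {suc J} f j≤J with j ≟ suc J
... | yes refl = ≤-refl
... | no  j≢J  = ≤-trans (∑-downFrom-mono f (s≤s⁻¹ (≤∧≢⇒< j≤J j≢J))) (m≤n+m _ (f J))

-- S marks form S(S - 1)/2 pairs, which is never less than S - 1.
marks≤1+pairs : ∀ J (f : ℕ → Bool) →
  ∑ (downFrom J) (λ j → ⟦ f j ⟧) ≤ 1 + ∑ (downFrom J) (λ j → ∑ (downFrom j) (λ i → ⟦ f i ⟧ * ⟦ f j ⟧))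
marks≤1+pairs zero    f = z≤n
marks≤1+pairs (suc J) f = subst (λ z → ⟦ f J ⟧ + S ≤ 1 + (z + Q)) (sym (∑-*ʳ (downFrom J) ⟦ f J ⟧ _))
    (go (f J) S Q (marks≤1+pairs J f))
  where
  S = ∑ (downFrom J) (λ j → ⟦ f j ⟧)
  Q = ∑ (downFrom J) (λ j → ∑ (downFrom j) (λ i → ⟦ f i ⟧ * ⟦ f j ⟧))
  go : ∀ b S Q → S ≤ 1 + Q → ⟦ b ⟧ + S ≤ 1 + (S * ⟦ b ⟧ + Q)
  go false S       Q h rewrite *-zeroʳ S = h
  go true  zero    Q h = s≤s z≤n
  go true  (suc S) Q h rewrite *-identityʳ S = s≤s (s≤s (m≤m+n S Q))

∑-at-most-one : ∀ J s l v → 1 ≤ s → ∑ (downFrom J) (λ j → ⟦ v ≡ᵇ l + s * j ⟧) ≤ 1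
∑-at-most-one zero    s l v 1≤s = z≤n
∑-at-most-one (suc J) s l v 1≤s with v ≡ᵇ l + s * J in e
... | false = ∑-at-most-one J s l v 1≤s
... | true  = s≤s (≤-trans (∑-mono (downFrom J) λ j j∈ → later j (∈-downFrom⁻ j∈)) (≤-reflexive (∑-zero (downFrom J))))
  where
  v≡ : v ≡ l + s * J
  v≡ = ≡ᵇ⇒≡ v _ (subst T (sym e) _)
  later : ∀ j → j < J → ⟦ v ≡ᵇ l + s * j ⟧ ≤ 0
  later j j<J with v ≡ᵇ l + s * j in e′
  ... | false = z≤n
  ... | true  = ⊥-elim (<⇒≢ (*-monoʳ-< s {{>-nonZero 1≤s}} j<J)
                  (+-cancelˡ-≡ l _ _ (trans (sym (≡ᵇ⇒≡ v _ (subst T (sym e′) _))) v≡)))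

notTilted? : ∀ p q {n} (A B : Subset n) → Dec (NotTilted p q A B)
notTilted? p q A B = ¬? (q * ∣ A ─ B ∣ ≟ p * ∣ B ─ A ∣) ×-dec ¬? (q * ∣ B ─ A ∣ ≟ p * ∣ A ─ B ∣)

notTilted : ∀ p q {n} → Subset n → Subset n → Bool
notTilted p q A B = does (notTilted? p q A B)

-- For an ordering u of the ground set, chain u j is the set of elements at the positions
-- p j, …, l + q j - 1: passing from i to j > i removes p (j - i) elements and adds q (j - i).
module Chains (p q n l J Y : ℕ) (p<q : p < q) (pJ≤l : p * J ≤ l) (fits : l + q * J + Y ≤ n) where

  private
    s = q ∸ p
    1≤s : 1 ≤ s
    1≤s = m<n⇒0<n∸m p<q
    s+p≡q : s + p ≡ q
    s+p≡q = m∸n+n≡m (<⇒≤ p<q)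
    Π = orderings n (downFrom n)
    S = allSubsets n

  χ : ℕ → ℕ → Bool
  χ j = interval (p * j) (l + q * j)

  chain : Vec ℕ n → ℕ → Subset n
  chain u j = Vec.map (χ j) u

  level : ℕ → ℕ
  level j = l + s * j

  -- n! times the probability that A is the j-th set of a random chain.
  weight : ℕ → Subset n → ℕ
  weight j A = ∑ Π (λ u → ⟦ A == chain u j ⟧)

  private
    top≤n : ∀ {j} → j ≤ J → l + q * j + Y ≤ n
    top≤n j≤J = ≤-trans (+-monoˡ-≤ Y (+-monoʳ-≤ l (*-monoʳ-≤ q j≤J))) fits

    -- No window starts after another one has ended. This gives the order of the four endpoints on
    -- which the counts of removed and added positions depend.
    bottom≤top : ∀ {i j} → j ≤ J → p * j ≤ l + q * i
    bottom≤top j≤J = ≤-trans (*-monoʳ-≤ p j≤J) (≤-trans pJ≤l (m≤m+n l _))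

  cnt-χ : ∀ {j} → j ≤ J → cnt (χ j) (downFrom n) ≡ level j
  cnt-χ {j} j≤J = +-cancelʳ-≡ (p * j) _ _ (begin
    cnt (χ j) (downFrom n) + p * j
      ≡⟨ cnt-interval n (bottom≤top {j} j≤J) (m+n≤o⇒m≤o _ (top≤n j≤J)) ⟩
    l + q * j             ≡⟨ cong (λ z → l + z * j) s+p≡q ⟨
    l + (s + p) * j       ≡⟨ lem l s p j ⟩
    l + s * j + p * j ∎)
    where
    open ≡-Reasoning
    lem : ∀ l s p j → l + (s + p) * j ≡ l + s * j + p * j
    lem = solve-∀

  ∣chain∣ : ∀ {u j} → u ∈ Π → j ≤ J → ∣ chain u j ∣ ≡ level j
  ∣chain∣ {u} {j} u∈ j≤J = trans (∣map∣ (χ j) n (downFrom n) (length-downFrom n) u∈) (cnt-χ j≤J)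

  weight-value : ∀ {j} A → j ≤ J → ∣ A ∣ ≡ level j → weight j A ≡ ∣ A ∣ ! * (n ∸ ∣ A ∣) !
  weight-value {j} A j≤J ∣A∣ = begin
    weight j A
      ≡⟨ count-words₁ (χ j) A (downFrom n) ⟩
    words₁ a b A
      ≡⟨ words₁-value A a b a+b≡n ∣A∣≡a ⟩
    a ! * b !
      ≡⟨ cong₂ (λ y z → y ! * z !) (sym ∣A∣≡a) (trans (sym (m+n∸m≡n a b)) (cong₂ _∸_ a+b≡n (sym ∣A∣≡a))) ⟩
    ∣ A ∣ ! * (n ∸ ∣ A ∣) ! ∎
    where
    open ≡-Reasoning
    a = cnt (χ j) (downFrom n)
    b = cnt (not ∘ χ j) (downFrom n)
    a+b≡n : a + b ≡ n
    a+b≡n = trans (cnt-not (χ j) (downFrom n)) (length-downFrom n)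
    ∣A∣≡a : ∣ A ∣ ≡ a
    ∣A∣≡a = trans ∣A∣ (sym (cnt-χ j≤J))

  module _ {i j} (i<j : i < j) (j≤J : j ≤ J) where

    private
      d = j ∸ i
      i+d≡j : i + d ≡ j
      i+d≡j = m+[n∸m]≡n (<⇒≤ i<j)
      α≤β : p * i ≤ p * j
      α≤β = *-monoʳ-≤ p (<⇒≤ i<j)
      β≤γ : p * j ≤ l + q * i
      β≤γ = bottom≤top {i} j≤J
      γ≤δ : l + q * i ≤ l + q * j
      γ≤δ = +-monoʳ-≤ l (*-monoʳ-≤ q (<⇒≤ i<j))
      δ≤n : l + q * j ≤ n
      δ≤n = m+n≤o⇒m≤o _ (top≤n j≤J)

      removed : cnt (labels (χ i) (χ j) true false) (downFrom n) ≡ p * d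
      removed = +-cancelʳ-≡ (p * i) _ _ (trans (cnt-removed α≤β β≤γ γ≤δ n (≤-trans γ≤δ δ≤n))
        (trans (cong (p *_) (sym i+d≡j)) (lem p i d)))
        where lem : ∀ p i d → p * (i + d) ≡ p * d + p * i
              lem = solve-∀

      added : cnt (labels (χ i) (χ j) false true) (downFrom n) ≡ q * d
      added = +-cancelʳ-≡ (l + q * i) _ _ (trans (cnt-added α≤β β≤γ γ≤δ n δ≤n)
        (trans (cong (λ z → l + q * z) (sym i+d≡j)) (lem l q i d)))
        where lem : ∀ l q i d → l + q * (i + d) ≡ q * d + (l + q * i)
              lem = solve-∀

      1≤added : 1 ≤ cnt (labels (χ i) (χ j) false true) (downFrom n)
      1≤added = subst (1 ≤_) (sym added) (*-mono-≤ (≤-trans 1≤s (m∸n≤m q p)) (m<n⇒0<n∸m i<j))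

      Y≤outside : Y ≤ cnt (labels (χ i) (χ j) false false) (downFrom n)
      Y≤outside = +-cancelʳ-≤ (l + q * j) _ _ (≤-trans (≤-trans (≤-reflexive (+-comm Y _)) (top≤n j≤J))
        (cnt-outside α≤β β≤γ γ≤δ n δ≤n))

      flip : ∀ (x : ℕ) → labels (χ j) (χ i) true false x ≡ labels (χ i) (χ j) false true x
      flip x with χ i x | χ j x
      ... | true  | true  = refl
      ... | true  | false = refl
      ... | false | true  = refl
      ... | false | false = refl

    chain-tilted : ∀ {u} → u ∈ Π → notTilted p q (chain u i) (chain u j) ≡ false
    chain-tilted {u} u∈ = dec-false (notTilted? p q (chain u i) (chain u j)) λ nt → proj₁ nt (begin
      q * ∣ chain u i ─ chain u j ∣
        ≡⟨ cong (q *_) (trans (cong ∣_∣ (map-─ (χ i) (χ j) u)) (trans (∣map∣ _ n (downFrom n) (length-downFrom n) u∈) removed)) ⟩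
      q * (p * d)
        ≡⟨ x∙yz≈y∙xz q p d ⟩
      p * (q * d)
        ≡⟨ cong (p *_) (trans (cong ∣_∣ (map-─ (χ j) (χ i) u)) (trans (∣map∣ _ n (downFrom n) (length-downFrom n) u∈)
             (trans (∑-cong (downFrom n) λ x _ → cong ⟦_⟧ (flip x)) added))) ⟨
      p * ∣ chain u j ─ chain u i ∣ ∎)
      where
      open ≡-Reasoning

    pair-weight : Subset n → Subset n → ℕ
    pair-weight A B = ∑ Π (λ u → ⟦ A == chain u i ⟧ * ⟦ B == chain u j ⟧)

    -- Only joined pairs with B on level j occur on a chain, so the indicator may be inserted before
    -- `count-pair-gap` is applied. Recording the level ensures that a later sum over j counts each
    -- neighbour B at most once.
    pair-weight-bound : ∀ A B →
      Y * pair-weight A B ≤ weight i A * ⟦ not (notTilted p q A B) ∧ (∣ B ∣ ≡ᵇ level j) ⟧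
    pair-weight-bound A B = begin
      Y * pair-weight A B
        ≤⟨ *-monoʳ-≤ Y (∑-mono Π λ u u∈ → support u u∈) ⟩
      Y * ∑ Π (λ u → ⟦ A == chain u i ⟧ * ⟦ B == chain u j ⟧ * ⟦ b ⟧)
        ≡⟨ cong (Y *_) (∑-*ʳ Π ⟦ b ⟧ _) ⟩
      Y * (pair-weight A B * ⟦ b ⟧)
        ≡⟨ *-assoc Y _ _ ⟨
      Y * pair-weight A B * ⟦ b ⟧
        ≤⟨ *-monoˡ-≤ ⟦ b ⟧ (≤-trans (*-monoˡ-≤ (pair-weight A B) (≤-trans Y≤outside (n≤1+n _)))
             (count-pair-gap (χ i) (χ j) A B (downFrom n) (length-downFrom n) 1≤added)) ⟩
      weight i A * ⟦ b ⟧ ∎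
      where
      open ≤-Reasoning
      b = not (notTilted p q A B) ∧ (∣ B ∣ ≡ᵇ level j)
      support : ∀ u → u ∈ Π →
        ⟦ A == chain u i ⟧ * ⟦ B == chain u j ⟧ ≤ ⟦ A == chain u i ⟧ * ⟦ B == chain u j ⟧ * ⟦ b ⟧
      support u u∈ with A == chain u i in eA | B == chain u j in eB
      ... | false | _     = z≤n
      ... | true  | false = z≤n
      ... | true  | true  = ≤-reflexive (sym (trans (+-identityʳ _) (cong ⟦_⟧ b≡true)))
        where
        b≡true : b ≡ true
        b≡true rewrite ==⇒≡ A _ eA | ==⇒≡ B _ eB | chain-tilted u∈ | ∣chain∣ {u} u∈ j≤J =
          T⇒≡ (≡⇒≡ᵇ (level j) (level j) refl)
          where T⇒≡ : ∀ {b} → T b → b ≡ true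
                T⇒≡ {true} _ = refl

  -- Double counting of the pairs of members of F on a random chain.
  module _ (F : Subset n → Bool) (e : ℕ)
    (sparse : ∀ A → F A ≡ true → ∑ S (λ B → ⟦ F B ∧ not (notTilted p q A B) ⟧) ≤ e) where

    -- n! times the mean number of members of F on a chain.
    total : ℕ
    total = ∑ (downFrom J) (λ j → ∑ S (λ A → ⟦ F A ⟧ * weight j A))

    private
      neighbours : ℕ → Subset n → ℕ
      neighbours j A = ∑ S (λ B → ⟦ F B ⟧ * ⟦ not (notTilted p q A B) ∧ (∣ B ∣ ≡ᵇ level j) ⟧)

      G : ℕ → ℕ → ℕ
      G i j = ∑ S (λ A → ⟦ F A ⟧ * weight i A * neighbours j A)

      ∑-marks : ∀ j → ∑ S (λ A → ⟦ F A ⟧ * weight j A) ≡ ∑ Π (λ u → ⟦ F (chain u j) ⟧)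
      ∑-marks j = begin
        ∑ S (λ A → ⟦ F A ⟧ * weight j A)
          ≡⟨ ∑-cong S (λ A _ → sym (∑-*ˡ Π ⟦ F A ⟧ _)) ⟩
        ∑ S (λ A → ∑ Π (λ u → ⟦ F A ⟧ * ⟦ A == chain u j ⟧))
          ≡⟨ ∑-swap S Π _ ⟩
        ∑ Π (λ u → ∑ S (λ A → ⟦ F A ⟧ * ⟦ A == chain u j ⟧))
          ≡⟨ ∑-cong Π (λ u _ → trans (∑-cong S λ A _ → *-comm ⟦ F A ⟧ _) (∑-== n (chain u j) (λ A → ⟦ F A ⟧))) ⟩
        ∑ Π (λ u → ⟦ F (chain u j) ⟧) ∎
        where open ≡-Reasoning

      pairs : ∀ {i j} (i<j : i < j) (j≤J : j ≤ J) →
        Y * ∑ Π (λ u → ⟦ F (chain u i) ⟧ * ⟦ F (chain u j) ⟧) ≤ G i j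
      pairs {i} {j} i<j j≤J = begin
        Y * ∑ Π (λ u → ⟦ F (chain u i) ⟧ * ⟦ F (chain u j) ⟧)
          ≡⟨ cong (Y *_) (∑-cong Π λ u _ → sym (expand u)) ⟩
        Y * ∑ Π (λ u → ∑ S (λ A → ∑ S (λ B → ⟦ F A ⟧ * ⟦ F B ⟧ * (⟦ A == chain u i ⟧ * ⟦ B == chain u j ⟧))))
          ≡⟨ cong (Y *_) (trans (∑-swap Π S _) (∑-cong S λ A _ → trans (∑-swap Π S _) (∑-cong S λ B _ → ∑-*ˡ Π (⟦ F A ⟧ * ⟦ F B ⟧) _))) ⟩
        Y * ∑ S (λ A → ∑ S (λ B → ⟦ F A ⟧ * ⟦ F B ⟧ * pair-weight i<j j≤J A B))
          ≡⟨ trans (sym (∑-*ˡ S Y _)) (∑-cong S λ A _ → sym (∑-*ˡ S Y _)) ⟩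
        ∑ S (λ A → ∑ S (λ B → Y * (⟦ F A ⟧ * ⟦ F B ⟧ * pair-weight i<j j≤J A B)))
          ≤⟨ ∑-mono S (λ A _ → ∑-mono S λ B _ → bound A B) ⟩
        ∑ S (λ A → ∑ S (λ B → ⟦ F A ⟧ * weight i A * (⟦ F B ⟧ * ⟦ not (notTilted p q A B) ∧ (∣ B ∣ ≡ᵇ level j) ⟧)))
          ≡⟨ ∑-cong S (λ A _ → ∑-*ˡ S (⟦ F A ⟧ * weight i A) _) ⟩
        G i j ∎
        where
        open ≤-Reasoning
        shuffle : ∀ x y z w → x * y * (z * w) ≡ w * (z * (x * y))
        shuffle = solve-∀
        expand : ∀ u → ∑ S (λ A → ∑ S (λ B → ⟦ F A ⟧ * ⟦ F B ⟧ * (⟦ A == chain u i ⟧ * ⟦ B == chain u j ⟧)))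
                     ≡ ⟦ F (chain u i) ⟧ * ⟦ F (chain u j) ⟧
        expand u = trans
          (∑-cong S λ A _ → trans
            (∑-cong S λ B _ → shuffle ⟦ F A ⟧ ⟦ F B ⟧ ⟦ A == chain u i ⟧ ⟦ B == chain u j ⟧)
            (∑-== n (chain u j) (λ B → ⟦ A == chain u i ⟧ * (⟦ F A ⟧ * ⟦ F B ⟧))))
          (∑-== n (chain u i) (λ A → ⟦ F A ⟧ * ⟦ F (chain u j) ⟧))
        bound : ∀ A B → Y * (⟦ F A ⟧ * ⟦ F B ⟧ * pair-weight i<j j≤J A B)
          ≤ ⟦ F A ⟧ * weight i A * (⟦ F B ⟧ * ⟦ not (notTilted p q A B) ∧ (∣ B ∣ ≡ᵇ level j) ⟧)
        bound A B = begin
          Y * (⟦ F A ⟧ * ⟦ F B ⟧ * pair-weight i<j j≤J A B)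
            ≡⟨ lem₁ Y ⟦ F A ⟧ ⟦ F B ⟧ _ ⟩
          ⟦ F A ⟧ * ⟦ F B ⟧ * (Y * pair-weight i<j j≤J A B)
            ≤⟨ *-monoʳ-≤ (⟦ F A ⟧ * ⟦ F B ⟧) (pair-weight-bound i<j j≤J A B) ⟩
          ⟦ F A ⟧ * ⟦ F B ⟧ * (weight i A * ⟦ not (notTilted p q A B) ∧ (∣ B ∣ ≡ᵇ level j) ⟧)
            ≡⟨ lem₂ ⟦ F A ⟧ ⟦ F B ⟧ (weight i A) _ ⟩
          _ ∎
          where
          lem₁ : ∀ y a b c → y * (a * b * c) ≡ a * b * (y * c)
          lem₁ = solve-∀
          lem₂ : ∀ a b c d → a * b * (c * d) ≡ a * c * (b * d)
          lem₂ = solve-∀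

      ∑-neighbours : ∀ A → F A ≡ true → ∑ (downFrom J) (λ j → neighbours j A) ≤ e
      ∑-neighbours A FA = begin
        ∑ (downFrom J) (λ j → neighbours j A)
          ≡⟨ ∑-swap (downFrom J) S _ ⟩
        ∑ S (λ B → ∑ (downFrom J) (λ j → ⟦ F B ⟧ * ⟦ not (notTilted p q A B) ∧ (∣ B ∣ ≡ᵇ level j) ⟧))
          ≤⟨ ∑-mono S (λ B _ → once B) ⟩
        ∑ S (λ B → ⟦ F B ∧ not (notTilted p q A B) ⟧)
          ≤⟨ sparse A FA ⟩
        e ∎
        where
        open ≤-Reasoning
        once : ∀ B → ∑ (downFrom J) (λ j → ⟦ F B ⟧ * ⟦ not (notTilted p q A B) ∧ (∣ B ∣ ≡ᵇ level j) ⟧)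
                     ≤ ⟦ F B ∧ not (notTilted p q A B) ⟧
        once B with F B | not (notTilted p q A B)
        ... | false | _     = ≤-reflexive (∑-zero (downFrom J))
        ... | true  | false = ≤-reflexive (∑-zero (downFrom J))
        ... | true  | true  = ≤-trans (≤-reflexive (∑-cong (downFrom J) λ _ _ → +-identityʳ _))
                                (∑-at-most-one J s l ∣ B ∣ 1≤s)

    -- A chain has at most one member more than it has pairs of members. Conditioning a pair on its
    -- lower set A leaves at most e candidates for the other set, each of probability at most 1/Y.
    total-bound : Y * total ≤ Y * n ! + e * total
    total-bound = begin
      Y * total
        ≡⟨ cong (Y *_) (trans (∑-cong (downFrom J) λ j _ → ∑-marks j) (∑-swap (downFrom J) Π _)) ⟩
      Y * ∑ Π (λ u → ∑ (downFrom J) (λ j → ⟦ F (chain u j) ⟧))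
        ≤⟨ *-monoʳ-≤ Y (∑-mono Π λ u _ → marks≤1+pairs J (F ∘ chain u)) ⟩
      Y * ∑ Π (λ u → 1 + ∑ (downFrom J) (λ j → ∑ (downFrom j) (λ i → ⟦ F (chain u i) ⟧ * ⟦ F (chain u j) ⟧)))
        ≡⟨ cong (Y *_) (trans (∑-+ Π _ _) (cong₂ _+_ (∑-orderings-1 n (downFrom n) (length-downFrom n))
             (trans (∑-swap Π (downFrom J) _) (∑-cong (downFrom J) λ j _ → ∑-swap Π (downFrom j) _)))) ⟩
      Y * (n ! + ∑ (downFrom J) (λ j → ∑ (downFrom j) (λ i → ∑ Π (λ u → ⟦ F (chain u i) ⟧ * ⟦ F (chain u j) ⟧))))
        ≡⟨ trans (*-distribˡ-+ Y (n !) _) (cong (Y * n ! +_) (trans (sym (∑-*ˡ (downFrom J) Y _))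
             (∑-cong (downFrom J) λ j _ → sym (∑-*ˡ (downFrom j) Y _)))) ⟩
      Y * n ! + ∑ (downFrom J) (λ j → ∑ (downFrom j) (λ i → Y * ∑ Π (λ u → ⟦ F (chain u i) ⟧ * ⟦ F (chain u j) ⟧)))
        ≤⟨ +-monoʳ-≤ (Y * n !) (∑-mono (downFrom J) λ j j∈ → ∑-mono (downFrom j) λ i i∈ →
             pairs (∈-downFrom⁻ i∈) (<⇒≤ (∈-downFrom⁻ j∈))) ⟩
      Y * n ! + ∑ (downFrom J) (λ j → ∑ (downFrom j) (λ i → G i j))
        -- Dropping the condition i < j lets j be summed for each fixed A, where all neighbours
        -- together number at most e.
        ≤⟨ +-monoʳ-≤ (Y * n !) (∑-mono (downFrom J) λ j j∈ → ∑-downFrom-mono (λ i → G i j) (<⇒≤ (∈-downFrom⁻ j∈))) ⟩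
      Y * n ! + ∑ (downFrom J) (λ j → ∑ (downFrom J) (λ i → G i j))
        ≡⟨ cong (Y * n ! +_) (trans (∑-swap (downFrom J) (downFrom J) _) (∑-cong (downFrom J) λ i _ →
             trans (∑-swap (downFrom J) S _) (∑-cong S λ A _ → ∑-*ˡ (downFrom J) (⟦ F A ⟧ * weight i A) _))) ⟩
      Y * n ! + ∑ (downFrom J) (λ i → ∑ S (λ A → ⟦ F A ⟧ * weight i A * ∑ (downFrom J) (λ j → neighbours j A)))
        ≤⟨ +-monoʳ-≤ (Y * n !) (∑-mono (downFrom J) λ i _ → ∑-mono S λ A _ → few i A) ⟩
      Y * n ! + ∑ (downFrom J) (λ i → ∑ S (λ A → e * (⟦ F A ⟧ * weight i A)))
        ≡⟨ cong (Y * n ! +_) (trans (∑-cong (downFrom J) λ i _ → ∑-*ˡ S e _) (∑-*ˡ (downFrom J) e _)) ⟩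
      Y * n ! + e * total ∎
      where
      open ≤-Reasoning
      few : ∀ i A → ⟦ F A ⟧ * weight i A * ∑ (downFrom J) (λ j → neighbours j A) ≤ e * (⟦ F A ⟧ * weight i A)
      few i A with F A in FA
      ... | false = z≤n
      ... | true  = ≤-trans (≤-reflexive (*-comm (1 * weight i A) _)) (*-monoˡ-≤ (1 * weight i A) (∑-neighbours A FA))

-- Binomial coefficients

C-factorial : ∀ {n k} → k ≤ n → (n C k) * (k ! * (n ∸ k) !) ≡ n !
C-factorial {n} {k} k≤n = trans (cong (_* (k ! * (n ∸ k) !)) (nCk≡n!/k![n-k]! k≤n))
  (m/n*n≡m (k![n∸k]!∣n! k≤n))
  where instance _ = k !* (n ∸ k) !≢0

C-step : ∀ n k → (n C suc k) * suc k ≡ (n C k) * (n ∸ k)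
C-step n k with k <? n
... | no  k≮n = trans (cong (_* suc k) (k>n⇒nCk≡0 (s≤s (≮⇒≥ k≮n))))
                  (sym (trans (cong ((n C k) *_) (m≤n⇒m∸n≡0 (≮⇒≥ k≮n))) (*-zeroʳ (n C k))))
... | yes k<n = *-cancelʳ-≡ _ _ (k ! * r !) (begin
    (n C suc k) * suc k * (k ! * r !)        ≡⟨ lem₁ (n C suc k) (suc k) (k !) (r !) ⟩
    (n C suc k) * (suc k * k ! * r !)        ≡⟨ C-factorial k<n ⟩
    n !                                      ≡⟨ C-factorial (<⇒≤ k<n) ⟨
    (n C k) * (k ! * (n ∸ k) !)              ≡⟨ cong (λ z → (n C k) * (k ! * z !)) n∸k≡ ⟩
    (n C k) * (k ! * (suc r * r !))          ≡⟨ lem₂ (n C k) (k !) (suc r) (r !) ⟩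
    (n C k) * suc r * (k ! * r !)            ≡⟨ cong (λ z → (n C k) * z * (k ! * r !)) n∸k≡ ⟨
    (n C k) * (n ∸ k) * (k ! * r !) ∎)
  where
  open ≡-Reasoning
  r = n ∸ suc k
  n∸k≡ : n ∸ k ≡ suc r
  n∸k≡ = +-∸-assoc 1 k<n
  instance _ = k !* r !≢0
  lem₁ : ∀ c a b d → c * a * (b * d) ≡ c * (a * b * d)
  lem₁ = solve-∀
  lem₂ : ∀ c a b d → c * (a * (b * d)) ≡ c * b * (a * d)
  lem₂ = solve-∀

double-half : ∀ n → n ≡ ⌊ n /2⌋ + ⌊ n /2⌋ ⊎ n ≡ suc (⌊ n /2⌋ + ⌊ n /2⌋)
double-half zero          = inj₁ refl
double-half (suc zero)    = inj₂ refl
double-half (suc (suc n)) with double-half n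
... | inj₁ e = inj₁ (cong suc (trans (cong suc e) (sym (+-suc _ _))))
... | inj₂ e = inj₂ (cong suc (cong suc (trans e (sym (+-suc _ _)))))

2half≤ : ∀ n → ⌊ n /2⌋ + ⌊ n /2⌋ ≤ n
2half≤ n with double-half n
... | inj₁ e = ≤-reflexive (sym e)
... | inj₂ e = ≤-trans (n≤1+n _) (≤-reflexive (sym e))

≤1+2half : ∀ n → n ≤ suc (⌊ n /2⌋ + ⌊ n /2⌋)
≤1+2half n with double-half n
... | inj₁ e = ≤-trans (≤-reflexive e) (n≤1+n _)
... | inj₂ e = ≤-reflexive e

C-increasing : ∀ n d → d ≤ ⌊ n /2⌋ → (n C (⌊ n /2⌋ ∸ d)) ≤ middleBinom n
C-increasing n zero    _   = ≤-refl
C-increasing n (suc d) d<h = ≤-trans (*-cancelʳ-≤ _ _ (suc k) (begin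
    (n C k) * suc k        ≤⟨ *-monoʳ-≤ (n C k) (m+n≤o⇒m≤o∸n (suc k) sk+k≤n) ⟩
    (n C k) * (n ∸ k)      ≡⟨ C-step n k ⟨
    (n C suc k) * suc k ∎))
  (≤-trans (≤-reflexive (cong (n C_) (sym (+-∸-assoc 1 d<h)))) (C-increasing n d (<⇒≤ d<h)))
  where
  open ≤-Reasoning
  k = ⌊ n /2⌋ ∸ suc d
  sk≤h : suc k ≤ ⌊ n /2⌋
  sk≤h = ≤-trans (≤-reflexive (sym (+-∸-assoc 1 d<h))) (m∸n≤m ⌊ n /2⌋ d)
  sk+k≤n : suc k + k ≤ n
  sk+k≤n = ≤-trans (+-mono-≤ sk≤h (<⇒≤ sk≤h)) (2half≤ n)

C≤middle : ∀ n k → (n C k) ≤ middleBinom n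
C≤middle n k with k ≤? ⌊ n /2⌋
... | yes k≤h = ≤-trans (≤-reflexive (cong (n C_) (sym (m∸[m∸n]≡n k≤h)))) (C-increasing n (⌊ n /2⌋ ∸ k) (m∸n≤m ⌊ n /2⌋ k))
... | no  k≰h with k ≤? n
...   | no  k≰n = ≤-trans (≤-reflexive (k>n⇒nCk≡0 (≰⇒> k≰n))) z≤n
...   | yes k≤n = ≤-trans (≤-reflexive (trans (nCk≡nC[n∸k] k≤n) (cong (n C_) (sym (m∸[m∸n]≡n n∸k≤h)))))
                    (C-increasing n (⌊ n /2⌋ ∸ (n ∸ k)) (m∸n≤m ⌊ n /2⌋ (n ∸ k)))
  where
  n∸k≤h : n ∸ k ≤ ⌊ n /2⌋
  n∸k≤h = m≤n+o⇒m∸n≤o n k (≤-trans (≤1+2half n) (+-monoˡ-≤ ⌊ n /2⌋ (≰⇒> k≰h)))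

central : ℕ → ℕ
central m = (m + m) C m

central-step : ∀ m → central (suc m) * suc m ≡ 2 * (suc (m + m) * central m)
central-step m = begin
  central (suc m) * suc m
    ≡⟨ cong (λ z → (suc z C suc m) * suc m) (+-suc m m) ⟩
  (suc (suc (m + m)) C suc m) * suc m
    ≡⟨ cong (_* suc m) (nCk+nC[k+1]≡[n+1]C[k+1] (suc (m + m)) m) ⟨
  ((suc (m + m) C m) + (suc (m + m) C suc m)) * suc m
    ≡⟨ cong (λ z → (z + (suc (m + m) C suc m)) * suc m) (trans (nCk≡nC[n∸k] {m} (≤-trans (m≤m+n m m) (n≤1+n _)))
         (cong (suc (m + m) C_) (m+n∸n≡m (suc m) m))) ⟩
  ((suc (m + m) C suc m) + (suc (m + m) C suc m)) * suc m
    ≡⟨ cong (λ z → (z + z) * suc m) (sym (nCk+nC[k+1]≡[n+1]C[k+1] (m + m) m)) ⟩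
  (x + y + (x + y)) * suc m
    ≡⟨ lem₁ x y m ⟩
  2 * (x * suc m + y * suc m)
    ≡⟨ cong (λ z → 2 * (x * suc m + z)) (trans (C-step (m + m) m) (cong (x *_) (m+n∸n≡m m m))) ⟩
  2 * (x * suc m + x * m)
    ≡⟨ lem₂ x m ⟩
  2 * (suc (m + m) * x) ∎
  where
  open ≡-Reasoning
  x = (m + m) C m
  y = (m + m) C suc m
  lem₁ : ∀ x y m → (x + y + (x + y)) * suc m ≡ 2 * (x * suc m + y * suc m)
  lem₁ = solve-∀
  lem₂ : ∀ x m → 2 * (x * suc m + x * m) ≡ 2 * (suc (m + m) * x)
  lem₂ = solve-∀

-- The squared form of central m ≥ 4^m / √(4m + 1). The step uses the ratio 2(2m + 1)/(m + 1) of
-- consecutive central coefficients and the identity 16(4m + 1)(m + 1)² + 4 = 4(4m + 5)(2m + 1)².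
central-bound : ∀ m → 2 ^ (m + m) * 2 ^ (m + m) ≤ suc (4 * m) * (central m * central m)
central-bound zero    = ≤-refl
central-bound (suc m) = *-cancelʳ-≤ _ _ (suc m * suc m) (begin
  2 ^ suc (m + suc m) * 2 ^ suc (m + suc m) * (suc m * suc m)
    ≡⟨ cong (λ z → 2 ^ suc z * 2 ^ suc z * (suc m * suc m)) (+-suc m m) ⟩
  2 * (2 * v) * (2 * (2 * v)) * (suc m * suc m)
    ≡⟨ lem₁ v (suc m) ⟩
  v * v * (16 * (suc m * suc m))
    ≤⟨ *-monoˡ-≤ (16 * (suc m * suc m)) (central-bound m) ⟩
  suc (4 * m) * (x * x) * (16 * (suc m * suc m))
    ≤⟨ m≤m+n _ (4 * (x * x)) ⟩
  suc (4 * m) * (x * x) * (16 * (suc m * suc m)) + 4 * (x * x)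
    ≡⟨ lem₂ m x ⟩
  suc (4 * suc m) * (2 * (suc (m + m) * x) * (2 * (suc (m + m) * x)))
    ≡⟨ cong (λ z → suc (4 * suc m) * (z * z)) (central-step m) ⟨
  suc (4 * suc m) * (central (suc m) * suc m * (central (suc m) * suc m))
    ≡⟨ lem₃ (suc (4 * suc m)) (central (suc m)) (suc m) ⟩
  suc (4 * suc m) * (central (suc m) * central (suc m)) * (suc m * suc m) ∎)
  where
  open ≤-Reasoning
  v = 2 ^ (m + m)
  x = central m
  lem₁ : ∀ v m → 2 * (2 * v) * (2 * (2 * v)) * (m * m) ≡ v * v * (16 * (m * m))
  lem₁ = solve-∀
  lem₂ : ∀ m x → suc (4 * m) * (x * x) * (16 * (suc m * suc m)) + 4 * (x * x)
               ≡ suc (4 * suc m) * (2 * (suc (m + m) * x) * (2 * (suc (m + m) * x)))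
  lem₂ = solve-∀
  lem₃ : ∀ a b c → a * (b * c * (b * c)) ≡ a * (b * b) * (c * c)
  lem₃ = solve-∀

-- For odd n = 2h + 1 the middle coefficient is merely compared with that of 2h. This loses a factor
-- 4, whence 8n.
4^n≤middle² : ∀ n → 2 ^ n * 2 ^ n ≤ suc (8 * n) * (middleBinom n * middleBinom n)
4^n≤middle² n with double-half n
... | inj₁ e = begin
    2 ^ n * 2 ^ n                           ≡⟨ cong (λ z → 2 ^ z * 2 ^ z) e ⟩
    2 ^ (h + h) * 2 ^ (h + h)               ≤⟨ central-bound h ⟩
    suc (4 * h) * (central h * central h)   ≡⟨ cong (λ z → suc (4 * h) * ((z C h) * (z C h))) e ⟨
    suc (4 * h) * (b * b)                   ≤⟨ *-monoˡ-≤ (b * b) (s≤s (*-mono-≤ {4} {8} (m≤m+n 4 4) (≤-trans (m≤m+n h h) (2half≤ n)))) ⟩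
    suc (8 * n) * (b * b) ∎
  where
  open ≤-Reasoning
  h = ⌊ n /2⌋
  b = middleBinom n
... | inj₂ e = begin
    2 ^ n * 2 ^ n                               ≡⟨ cong (λ z → 2 ^ z * 2 ^ z) e ⟩
    2 * v * (2 * v)                             ≡⟨ lem₁ v ⟩
    4 * (v * v)                                 ≤⟨ *-monoʳ-≤ 4 (central-bound h) ⟩
    4 * (suc (4 * h) * (central h * central h)) ≤⟨ *-monoʳ-≤ 4 (*-monoʳ-≤ (suc (4 * h)) (*-mono-≤ central≤b central≤b)) ⟩
    4 * (suc (4 * h) * (b * b))                 ≤⟨ m≤m+n _ (5 * (b * b)) ⟩
    4 * (suc (4 * h) * (b * b)) + 5 * (b * b)   ≡⟨ lem₂ h (b * b) ⟩
    suc (8 * suc (h + h)) * (b * b)             ≡⟨ cong (λ z → suc (8 * z) * (b * b)) e ⟨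
    suc (8 * n) * (b * b) ∎
  where
  open ≤-Reasoning
  h = ⌊ n /2⌋
  b = middleBinom n
  v = 2 ^ (h + h)
  central≤b : central h ≤ b
  central≤b = ≤-trans (≤-trans (m≤m+n _ _) (≤-reflexive (nCk+nC[k+1]≡[n+1]C[k+1] (h + h) h)))
    (≤-trans (≤-reflexive (cong (_C suc h) (sym e))) (C≤middle n (suc h)))
  lem₁ : ∀ v → 2 * v * (2 * v) ≡ 4 * (v * v)
  lem₁ = solve-∀
  lem₂ : ∀ h y → 4 * (suc (4 * h) * y) + 5 * y ≡ suc (8 * suc (h + h)) * y
  lem₂ = solve-∀

-- Chebyshev's inequality for the sizes of subsets

∑-subsets-suc : ∀ n (f : Subset (suc n) → ℕ) →
  ∑ (allSubsets (suc n)) f ≡ ∑ (allSubsets n) (λ A → f (true ∷ A) + f (false ∷ A))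
∑-subsets-suc n f = trans (∑-++ (map (true ∷_) (allSubsets n)) _ f)
  (trans (cong₂ _+_ (∑-map (true ∷_) (allSubsets n) f) (∑-map (false ∷_) (allSubsets n) f))
    (sym (∑-+ (allSubsets n) _ _)))

∑-one : ∀ n → ∑ (allSubsets n) (λ _ → 1) ≡ 2 ^ n
∑-one zero    = refl
∑-one (suc n) = trans (∑-subsets-suc n (λ _ → 1)) (trans (∑-+ (allSubsets n) (λ _ → 1) (λ _ → 1))
  (trans (cong₂ _+_ (∑-one n) (∑-one n)) (cong (2 ^ n +_) (sym (+-identityʳ _)))))

∑-size : ∀ n → 2 * ∑ (allSubsets n) ∣_∣ ≡ n * 2 ^ n
∑-size zero    = refl
∑-size (suc n) = begin
  2 * ∑ (allSubsets (suc n)) ∣_∣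
    ≡⟨ cong (2 *_) (∑-subsets-suc n ∣_∣) ⟩
  2 * ∑ (allSubsets n) (λ A → 1 + ∣ A ∣ + ∣ A ∣)
    ≡⟨ cong (2 *_) (trans (∑-+ (allSubsets n) (λ A → 1 + ∣ A ∣) ∣_∣) (cong (_+ s₁) (∑-+ (allSubsets n) (λ _ → 1) ∣_∣))) ⟩
  2 * (∑ (allSubsets n) (λ _ → 1) + s₁ + s₁)
    ≡⟨ cong (λ z → 2 * (z + s₁ + s₁)) (∑-one n) ⟩
  2 * (2 ^ n + s₁ + s₁)
    ≡⟨ lem₁ (2 ^ n) s₁ ⟩
  2 * 2 ^ n + 2 * (2 * s₁)
    ≡⟨ cong (λ z → 2 * 2 ^ n + 2 * z) (∑-size n) ⟩
  2 * 2 ^ n + 2 * (n * 2 ^ n)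
    ≡⟨ lem₂ n (2 ^ n) ⟩
  suc n * 2 ^ suc n ∎
  where
  open ≡-Reasoning
  s₁ = ∑ (allSubsets n) ∣_∣
  lem₁ : ∀ v s → 2 * (v + s + s) ≡ 2 * v + 2 * (2 * s)
  lem₁ = solve-∀
  lem₂ : ∀ n v → 2 * v + 2 * (n * v) ≡ suc n * (2 * v)
  lem₂ = solve-∀

∑-size² : ∀ n → 4 * ∑ (allSubsets n) (λ A → ∣ A ∣ * ∣ A ∣) ≡ n * suc n * 2 ^ n
∑-size² zero    = refl
∑-size² (suc n) = begin
  4 * ∑ (allSubsets (suc n)) (λ A → ∣ A ∣ * ∣ A ∣)
    ≡⟨ cong (4 *_) (∑-subsets-suc n (λ A → ∣ A ∣ * ∣ A ∣)) ⟩
  4 * ∑ (allSubsets n) (λ A → suc ∣ A ∣ * suc ∣ A ∣ + ∣ A ∣ * ∣ A ∣)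
    ≡⟨ cong (4 *_) (∑-cong (allSubsets n) λ A _ → lem₀ ∣ A ∣) ⟩
  4 * ∑ (allSubsets n) (λ A → 1 + 2 * ∣ A ∣ + 2 * (∣ A ∣ * ∣ A ∣))
    ≡⟨ cong (4 *_) (trans (∑-+ (allSubsets n) (λ A → 1 + 2 * ∣ A ∣) _) (cong₂ _+_
         (trans (∑-+ (allSubsets n) (λ _ → 1) _) (cong₂ _+_ (∑-one n) (trans (∑-*ˡ (allSubsets n) 2 ∣_∣) (∑-size n))))
         (∑-*ˡ (allSubsets n) 2 _))) ⟩
  4 * (2 ^ n + n * 2 ^ n + 2 * s₂)
    ≡⟨ lem₁ n (2 ^ n) s₂ ⟩
  4 * (suc n * 2 ^ n) + 2 * (4 * s₂)
    ≡⟨ cong (λ z → 4 * (suc n * 2 ^ n) + 2 * z) (∑-size² n) ⟩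
  4 * (suc n * 2 ^ n) + 2 * (n * suc n * 2 ^ n)
    ≡⟨ lem₂ n (2 ^ n) ⟩
  suc n * suc (suc n) * 2 ^ suc n ∎
  where
  open ≡-Reasoning
  s₂ = ∑ (allSubsets n) (λ A → ∣ A ∣ * ∣ A ∣)
  lem₀ : ∀ a → suc a * suc a + a * a ≡ 1 + 2 * a + 2 * (a * a)
  lem₀ = solve-∀
  lem₁ : ∀ n v s → 4 * (v + n * v + 2 * s) ≡ 4 * (suc n * v) + 2 * (4 * s)
  lem₁ = solve-∀
  lem₂ : ∀ n v → 4 * (suc n * v) + 2 * (n * suc n * v) ≡ suc n * suc (suc n) * (2 * v)
  lem₂ = solve-∀

-- (n - 2a)² ≥ (2m)² with both sides moved so that no subtraction occurs.
square-gap : ∀ n a m → a + a + (m + m) ≤ n ⊎ n + (m + m) ≤ a + a →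
  4 * (m * m) + 4 * n * a ≤ 4 * (a * a) + n * n
square-gap n a m (inj₁ h) = subst (λ n → 4 * (m * m) + 4 * n * a ≤ 4 * (a * a) + n * n) (m+[n∸m]≡n h)
  (≤-trans (m≤m+n _ _) (≤-reflexive (lem a m (n ∸ (a + a + (m + m))))))
  where
  lem : ∀ a m t → 4 * (m * m) + 4 * (a + a + (m + m) + t) * a + (t * t + 4 * m * t)
                ≡ 4 * (a * a) + (a + a + (m + m) + t) * (a + a + (m + m) + t)
  lem = solve-∀
square-gap n a m (inj₂ h) = begin
  4 * (m * m) + 4 * n * a                    ≡⟨ lem₁ n a m ⟩
  4 * (m * m) + 2 * n * (a + a)              ≤⟨ subst (λ d → 4 * (m * m) + 2 * n * d ≤ d * d + n * n) (m+[n∸m]≡n h)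
                                                  (≤-trans (m≤m+n _ _) (≤-reflexive (lem₂ n m (a + a ∸ (n + (m + m)))))) ⟩
  (a + a) * (a + a) + n * n                  ≡⟨ lem₃ n a ⟩
  4 * (a * a) + n * n ∎
  where
  open ≤-Reasoning
  lem₁ : ∀ n a m → 4 * (m * m) + 4 * n * a ≡ 4 * (m * m) + 2 * n * (a + a)
  lem₁ = solve-∀
  lem₂ : ∀ n m t → 4 * (m * m) + 2 * n * (n + (m + m) + t) + (t * t + 4 * m * t)
                 ≡ (n + (m + m) + t) * (n + (m + m) + t) + n * n
  lem₂ = solve-∀
  lem₃ : ∀ n a → (a + a) * (a + a) + n * n ≡ 4 * (a * a) + n * n
  lem₃ = solve-∀

-- The sum of (n - 2|A|)² over all A is n 2^n, and each far size contributes at least 4m². The cross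
-- term 4n|A| stands on both sides to avoid subtraction.
chebyshev : ∀ n m (far : ℕ → Bool) →
  (∀ a → far a ≡ true → a + a + (m + m) ≤ n ⊎ n + (m + m) ≤ a + a) →
  4 * (m * m) * ∑ (allSubsets n) (λ A → ⟦ far ∣ A ∣ ⟧) ≤ n * 2 ^ n
chebyshev n m far gap = +-cancelʳ-≤ (2 * n * (n * 2 ^ n)) _ _ (begin
  4 * (m * m) * ∑ S (λ A → ⟦ far ∣ A ∣ ⟧) + 2 * n * (n * 2 ^ n)
    ≡⟨ cong₂ _+_ (sym (∑-*ˡ S (4 * (m * m)) _)) (trans (cong (2 * n *_) (sym (∑-size n)))
         (trans (lem₁ n s₁) (sym (∑-*ˡ S (4 * n) ∣_∣)))) ⟩
  ∑ S (λ A → 4 * (m * m) * ⟦ far ∣ A ∣ ⟧) + ∑ S (λ A → 4 * n * ∣ A ∣)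
    ≡⟨ ∑-+ S _ _ ⟨
  ∑ S (λ A → 4 * (m * m) * ⟦ far ∣ A ∣ ⟧ + 4 * n * ∣ A ∣)
    ≤⟨ ∑-mono S (λ A _ → pointwise ∣ A ∣) ⟩
  ∑ S (λ A → 4 * (∣ A ∣ * ∣ A ∣) + n * n)
    ≡⟨ trans (∑-+ S _ _) (cong₂ _+_ (trans (∑-*ˡ S 4 _) (∑-size² n))
         (trans (∑-cong S λ _ _ → sym (*-identityʳ (n * n))) (trans (∑-*ˡ S (n * n) (λ _ → 1)) (cong (n * n *_) (∑-one n))))) ⟩
  n * suc n * 2 ^ n + n * n * 2 ^ n
    ≡⟨ lem₂ n (2 ^ n) ⟩
  n * 2 ^ n + 2 * n * (n * 2 ^ n) ∎)
  where
  open ≤-Reasoning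
  S = allSubsets n
  s₁ = ∑ S ∣_∣
  lem₁ : ∀ n s → 2 * n * (2 * s) ≡ 4 * n * s
  lem₁ = solve-∀
  lem₂ : ∀ n v → n * suc n * v + n * n * v ≡ n * v + 2 * n * (n * v)
  lem₂ = solve-∀
  pointwise : ∀ a → 4 * (m * m) * ⟦ far a ⟧ + 4 * n * a ≤ 4 * (a * a) + n * n
  pointwise a with far a in e
  ... | true  = ≤-trans (≤-reflexive (cong (_+ 4 * n * a) (*-identityʳ _))) (square-gap n a m (gap a e))
  -- Sizes that are not far only need (n - 2a)² ≥ 0, the case m = 0.
  ... | false = ≤-trans (≤-reflexive (cong (_+ 4 * n * a) (*-zeroʳ (4 * (m * m))))) (square-gap n a 0 either)
    where
    either : a + a + 0 ≤ n ⊎ n + 0 ≤ a + a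
    either with ≤-total (a + a) n
    ... | inj₁ h = inj₁ (≤-trans (≤-reflexive (+-identityʳ _)) h)
    ... | inj₂ h = inj₂ (≤-trans (≤-reflexive (+-identityʳ _)) h)

-- The middle layers

∑-single : ∀ {A : Set} (xs : List A) (f : A → ℕ) {x} → x ∈ xs → f x ≤ ∑ xs f
∑-single (x ∷ xs) f (here refl) = m≤m+n _ _
∑-single (y ∷ xs) f (there x∈)  = ≤-trans (∑-single xs f x∈) (m≤n+m _ (f y))

half-cancel : ∀ {x h} → x + x ≤ suc (h + h) → x ≤ h
half-cancel {x} {h} le = ≮⇒≥ λ h<x → <⇒≱ (s≤s le)
  (≤-trans (≤-reflexive (cong suc (sym (+-suc h h)))) (+-mono-≤ h<x h<x))

interval-bounds : ∀ lo hi a → interval lo hi a ≡ true → lo ≤ a × a < hi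
interval-bounds lo hi a e with a <ᵇ lo in e₁ | a <ᵇ hi in e₂
... | false | true = ≮⇒≥ (λ a<lo → subst T e₁ (<⇒<ᵇ a<lo)) , <ᵇ⇒< a hi (subst T (sym e₂) _)

interval-outside : ∀ lo hi a → not (interval lo hi a) ≡ true → a < lo ⊎ hi ≤ a
interval-outside lo hi a e with a <ᵇ lo in e₁ | a <ᵇ hi in e₂
... | true  | _     = inj₁ (<ᵇ⇒< a lo (subst T (sym e₁) _))
... | false | false = inj₂ (≮⇒≥ (λ a<hi → subst T e₂ (<⇒<ᵇ a<hi)))

-- For each r < s, the chains starting at level lo + r visit the levels lo + r + s j with j < J;
-- together they meet each level of `near` once. The windows need q J ≤ 3qm positions beyond their
-- start, and the room 8qm ≤ n also leaves m positions untouched, which serve as Y.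
module Window (p q m n : ℕ) (p<q : p < q) (1≤m : 1 ≤ m) (8qm≤n : 8 * (q * m) ≤ n) where

  s = q ∸ p
  J = suc (m + m)
  h = ⌊ n /2⌋
  lo = h ∸ s * m

  near : ℕ → Bool
  near = interval lo (lo + s * J)

  private
    S = allSubsets n
    1≤s : 1 ≤ s
    1≤s = m<n⇒0<n∸m p<q
    s≤q : s ≤ q
    s≤q = m∸n≤m q p
    1≤q : 1 ≤ q
    1≤q = ≤-trans 1≤s s≤q
    4qm≤h : 4 * (q * m) ≤ h
    4qm≤h = half-cancel (≤-trans (≤-reflexive (lem (q * m))) (≤-trans 8qm≤n (≤1+2half n)))
      where lem : ∀ x → 4 * x + 4 * x ≡ 8 * x
            lem = solve-∀
    sm≤qm : s * m ≤ q * m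
    sm≤qm = *-monoˡ-≤ m s≤q
    lo+sm≡h : lo + s * m ≡ h
    lo+sm≡h = m∸n+n≡m (≤-trans sm≤qm (≤-trans (m≤m+n (q * m) _) 4qm≤h))
    J≤3m : J ≤ 3 * m
    J≤3m = ≤-trans (+-monoˡ-≤ (m + m) 1≤m) (≤-reflexive (lem m))
      where lem : ∀ m → m + (m + m) ≡ 3 * m
            lem = solve-∀
    qJ≤3qm : q * J ≤ 3 * (q * m)
    qJ≤3qm = ≤-trans (*-monoʳ-≤ q J≤3m) (≤-reflexive (x∙yz≈y∙xz q 3 m))

    pJ≤l : ∀ r → p * J ≤ lo + r
    pJ≤l r = ≤-trans (+-cancelʳ-≤ (s * m) _ _ (begin
      p * J + s * m             ≤⟨ +-mono-≤ (≤-trans (*-monoˡ-≤ J (<⇒≤ p<q)) qJ≤3qm) sm≤qm ⟩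
      3 * (q * m) + q * m       ≡⟨ lem (q * m) ⟩
      4 * (q * m)               ≤⟨ 4qm≤h ⟩
      h                         ≡⟨ lo+sm≡h ⟨
      lo + s * m ∎)) (m≤m+n lo r)
      where
      open ≤-Reasoning
      lem : ∀ x → 3 * x + x ≡ 4 * x
      lem = solve-∀

    fits : ∀ {r} → r < s → lo + r + q * J + m ≤ n
    fits {r} r<s = begin
      lo + r + q * J + m
        ≤⟨ +-mono-≤ (+-mono-≤ (+-monoʳ-≤ lo r≤sm) qJ≤3qm) (m≤n*m m q {{>-nonZero 1≤q}}) ⟩
      lo + s * m + 3 * (q * m) + q * m
        ≡⟨ cong (λ z → z + 3 * (q * m) + q * m) lo+sm≡h ⟩
      h + 3 * (q * m) + q * m
        ≡⟨ lem h (q * m) ⟩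
      h + 4 * (q * m)
        ≤⟨ +-monoʳ-≤ h 4qm≤h ⟩
      h + h
        ≤⟨ 2half≤ n ⟩
      n ∎
      where
      open ≤-Reasoning
      r≤sm : r ≤ s * m
      r≤sm = ≤-trans (<⇒≤ r<s) (m≤m*n s m {{>-nonZero 1≤m}})
      lem : ∀ h x → h + 3 * x + x ≡ h + 4 * x
      lem = solve-∀

    near-level : ∀ a → near a ≡ true → ∃ λ r → ∃ λ j → r < s × j < J × a ≡ lo + r + s * j
    near-level a e = r , j , m%n<n k s , *-cancelˡ-< s j J (≤-<-trans sj≤k k<sJ) , a≡
      where
      instance _ = >-nonZero 1≤s
      bounds = interval-bounds lo (lo + s * J) a e
      k = a ∸ lo
      lo+k≡a : lo + k ≡ a
      lo+k≡a = m+[n∸m]≡n (proj₁ bounds)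
      r = k % s
      j = k / s
      k≡ : k ≡ r + j * s
      k≡ = m≡m%n+[m/n]*n k s
      k<sJ : k < s * J
      k<sJ = +-cancelˡ-< lo _ _ (≤-<-trans (≤-reflexive lo+k≡a) (proj₂ bounds))
      sj≤k : s * j ≤ k
      sj≤k = ≤-trans (≤-reflexive (*-comm s j)) (≤-trans (m≤n+m (j * s) r) (≤-reflexive (sym k≡)))
      a≡ : a ≡ lo + r + s * j
      a≡ = trans (sym lo+k≡a) (trans (cong (lo +_) (trans k≡ (cong (r +_) (*-comm j s)))) (sym (+-assoc lo r _)))

  -- With W the sum of the s values of `total`, a near set A has weight n!/C(n,|A|) ≥ n!/B at its
  -- place on a chain, so N n! ≤ B W. Summing `total-bound` gives (m - e) W ≤ s m n!, and e ≤ m/(st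
  -- + 1) turns this into W ≤ (s + 1/t) n!.
  near-bound : ∀ (F : Subset n → Bool) e t →
    (∀ A → F A ≡ true → ∑ S (λ B → ⟦ F B ∧ not (notTilted p q A B) ⟧) ≤ e) → e * suc (s * t) ≤ m →
    t * ∑ S (λ A → ⟦ F A ⟧ * ⟦ near ∣ A ∣ ⟧) ≤ suc (s * t) * middleBinom n
  near-bound F e t sparse et≤m = *-cancelˡ-≤ (n !) {{n !≢0}} (begin
    n ! * (t * N)                     ≡⟨ x∙yz≈y∙xz (n !) t N ⟩
    t * (n ! * N)                     ≤⟨ *-monoʳ-≤ t n!N≤BW ⟩
    t * (b * W)                       ≡⟨ x∙yz≈y∙xz t b W ⟩
    b * (t * W)                       ≤⟨ *-monoʳ-≤ b tW≤ ⟩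
    b * (suc (s * t) * n !)           ≡⟨ lem₂ b (suc (s * t)) (n !) ⟩
    n ! * (suc (s * t) * b) ∎)
    where
    open ≤-Reasoning
    lem₂ : ∀ x y z → x * (y * z) ≡ z * (y * x)
    lem₂ = solve-∀
    b = middleBinom n
    N = ∑ S (λ A → ⟦ F A ⟧ * ⟦ near ∣ A ∣ ⟧)
    weights : ℕ → ℕ → Subset n → ℕ
    weights r j A = ∑ (orderings n (downFrom n)) (λ u → ⟦ A == Vec.map (interval (p * j) (lo + r + q * j)) u ⟧)
    total : ℕ → ℕ
    total r = ∑ (downFrom J) (λ j → ∑ S (λ A → ⟦ F A ⟧ * weights r j A))
    W = ∑ (downFrom s) total
    W-bound : m * W ≤ s * (m * n !) + e * W
    W-bound = begin
      m * W
        ≡⟨ ∑-*ˡ (downFrom s) m total ⟨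
      ∑ (downFrom s) (λ r → m * total r)
        ≤⟨ ∑-mono (downFrom s) (λ r r∈ →
             Chains.total-bound p q n (lo + r) J m p<q (pJ≤l r) (fits (∈-downFrom⁻ r∈)) F e sparse) ⟩
      ∑ (downFrom s) (λ r → m * n ! + e * total r)
        ≡⟨ trans (∑-+ (downFrom s) _ _) (cong₂ _+_
             (trans (∑-const (downFrom s) _) (cong (_* (m * n !)) (length-downFrom s))) (∑-*ˡ (downFrom s) e total)) ⟩
      s * (m * n !) + e * W ∎
    tW≤ : t * W ≤ suc (s * t) * n !
    -- `m * W` is added to both sides to absorb the term `e * W` of `W-bound` after it has been
    -- scaled by st + 1.
    tW≤ = *-cancelˡ-≤ (s * m) {{m*n≢0 s m {{>-nonZero 1≤s}} {{>-nonZero 1≤m}}}} (+-cancelʳ-≤ (m * W) _ _ (begin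
      s * m * (t * W) + m * W                              ≡⟨ lem₃ s m t W ⟩
      suc (s * t) * (m * W)                                ≤⟨ *-monoʳ-≤ (suc (s * t)) W-bound ⟩
      suc (s * t) * (s * (m * n !) + e * W)                ≡⟨ lem₄ (suc (s * t)) s m (n !) e W ⟩
      s * m * (suc (s * t) * n !) + e * suc (s * t) * W    ≤⟨ +-monoʳ-≤ (s * m * (suc (s * t) * n !)) (*-monoˡ-≤ W et≤m) ⟩
      s * m * (suc (s * t) * n !) + m * W ∎))
      where
      lem₃ : ∀ s m t w → s * m * (t * w) + m * w ≡ suc (s * t) * (m * w)
      lem₃ = solve-∀
      lem₄ : ∀ c s m f e w → c * (s * (m * f) + e * w) ≡ s * m * (c * f) + e * c * w
      lem₄ = solve-∀
    heavy : ∀ A → near ∣ A ∣ ≡ true → n ! ≤ b * ∑ (downFrom s) (λ r → ∑ (downFrom J) (λ j → weights r j A))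
    heavy A e with near-level ∣ A ∣ e
    ... | r , j , r<s , j<J , ∣A∣≡ = begin
      n !
        ≡⟨ C-factorial (∣p∣≤n A) ⟨
      (n C ∣ A ∣) * (∣ A ∣ ! * (n ∸ ∣ A ∣) !)
        ≡⟨ cong ((n C ∣ A ∣) *_) (Chains.weight-value p q n (lo + r) J m p<q (pJ≤l r) (fits r<s) A (<⇒≤ j<J) ∣A∣≡) ⟨
      (n C ∣ A ∣) * weights r j A
        ≤⟨ *-mono-≤ (C≤middle n ∣ A ∣) (≤-trans (∑-single (downFrom J) (λ j → weights r j A) (∈-downFrom⁺ j<J))
             (∑-single (downFrom s) (λ r → ∑ (downFrom J) (λ j → weights r j A)) (∈-downFrom⁺ r<s))) ⟩
      b * ∑ (downFrom s) (λ r → ∑ (downFrom J) (λ j → weights r j A)) ∎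
    n!N≤BW : n ! * N ≤ b * W
    n!N≤BW = begin
      n ! * N
        ≡⟨ ∑-*ˡ S (n !) _ ⟨
      ∑ S (λ A → n ! * (⟦ F A ⟧ * ⟦ near ∣ A ∣ ⟧))
        ≤⟨ ∑-mono S (λ A _ → step A) ⟩
      ∑ S (λ A → b * (⟦ F A ⟧ * ∑ (downFrom s) (λ r → ∑ (downFrom J) (λ j → weights r j A))))
        ≡⟨ ∑-*ˡ S b _ ⟩
      b * ∑ S (λ A → ⟦ F A ⟧ * ∑ (downFrom s) (λ r → ∑ (downFrom J) (λ j → weights r j A)))
        ≡⟨ cong (b *_) (trans (∑-cong S λ A _ → trans (sym (∑-*ˡ (downFrom s) ⟦ F A ⟧ _))
             (∑-cong (downFrom s) λ r _ → sym (∑-*ˡ (downFrom J) ⟦ F A ⟧ _)))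
             (trans (∑-swap S (downFrom s) _) (∑-cong (downFrom s) λ r _ → ∑-swap S (downFrom J) _))) ⟩
      b * W ∎
      where
      step : ∀ A → n ! * (⟦ F A ⟧ * ⟦ near ∣ A ∣ ⟧)
                 ≤ b * (⟦ F A ⟧ * ∑ (downFrom s) (λ r → ∑ (downFrom J) (λ j → weights r j A)))
      step A with F A | near ∣ A ∣ in e
      ... | false | _     = ≤-trans (≤-reflexive (*-zeroʳ (n !))) z≤n
      ... | true  | false = ≤-trans (≤-reflexive (*-zeroʳ (n !))) z≤n
      ... | true  | true  = ≤-trans (≤-reflexive (*-identityʳ (n !)))
                              (≤-trans (heavy A e) (≤-reflexive (cong (b *_) (sym (+-identityʳ _)))))

  -- The levels left out are at distance at least m, of order n, from n/2. Chebyshev leaves a share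
  -- O(1/n) of the 2^n sets, which is o(B) since 2^n = O(√n B).
  far-bound : n ≤ 16 * (q * m) → m * ∑ S (λ A → ⟦ not (near ∣ A ∣) ⟧) ≤ 4 * q * 2 ^ n
  far-bound n≤16qm = *-cancelˡ-≤ (4 * m) {{m*n≢0 4 m {{_}} {{>-nonZero 1≤m}}}} (begin
    4 * m * (m * N)               ≡⟨ lem₁ m N ⟩
    4 * (m * m) * N               ≤⟨ chebyshev n m (not ∘ near) far-gap ⟩
    n * 2 ^ n                     ≤⟨ *-monoˡ-≤ (2 ^ n) n≤16qm ⟩
    16 * (q * m) * 2 ^ n          ≡⟨ lem₂ q m (2 ^ n) ⟩
    4 * m * (4 * q * 2 ^ n) ∎)
    where
    open ≤-Reasoning
    N = ∑ S (λ A → ⟦ not (near ∣ A ∣) ⟧)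
    lem₁ : ∀ m x → 4 * m * (m * x) ≡ 4 * (m * m) * x
    lem₁ = solve-∀
    lem₂ : ∀ q m v → 16 * (q * m) * v ≡ 4 * m * (4 * q * v)
    lem₂ = solve-∀
    m≤sm : m ≤ s * m
    m≤sm = m≤n*m m s {{>-nonZero 1≤s}}
    hi≡ : lo + s * J ≡ h + s + s * m
    hi≡ = trans (lem lo s m) (cong (λ z → z + s + s * m) lo+sm≡h)
      where lem : ∀ l s m → l + s * suc (m + m) ≡ l + s * m + s + s * m
            lem = solve-∀
    far-gap : ∀ a → not (near a) ≡ true → a + a + (m + m) ≤ n ⊎ n + (m + m) ≤ a + a
    far-gap a e with interval-outside lo (lo + s * J) a e
    ... | inj₁ a<lo = inj₁ (begin
      a + a + (m + m)         ≡⟨ lem a m ⟩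
      a + m + (a + m)         ≤⟨ +-mono-≤ a+m≤h a+m≤h ⟩
      h + h                   ≤⟨ 2half≤ n ⟩
      n ∎)
      where
      a+m≤h : a + m ≤ h
      a+m≤h = ≤-trans (+-mono-≤ (<⇒≤ a<lo) m≤sm) (≤-reflexive lo+sm≡h)
      lem : ∀ a m → a + a + (m + m) ≡ a + m + (a + m)
      lem = solve-∀
    ... | inj₂ hi≤a = inj₂ (begin
      n + (m + m)                   ≤⟨ +-monoˡ-≤ (m + m) (≤1+2half n) ⟩
      suc (h + h) + (m + m)         ≤⟨ n≤1+n _ ⟩
      suc (suc (h + h) + (m + m))   ≡⟨ lem h m ⟩
      h + 1 + m + (h + 1 + m)       ≤⟨ +-mono-≤ h+1+m≤a h+1+m≤a ⟩
      a + a ∎)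
      where
      -- The odd length J = 2m + 1 gives s ≥ 1 more levels above h than below; they absorb the
      -- rounding of n/2.
      h+1+m≤a : h + 1 + m ≤ a
      h+1+m≤a = ≤-trans (+-mono-≤ (+-monoʳ-≤ h 1≤s) m≤sm) (≤-trans (≤-reflexive (sym hi≡)) hi≤a)
      lem : ∀ h m → suc (suc (h + h) + (m + m)) ≡ h + 1 + m + (h + 1 + m)
      lem = solve-∀

-- Families of sets as independent sets

module _ {X : Set} {R : X → X → Set} (R? : ∀ x y → Dec (R x y)) where

  open Independent (λ x y → does (R? x y))

  private
    allᵇ : (X → Bool) → List X → Bool
    allᵇ P []       = true
    allᵇ P (x ∷ xs) = P x ∧ allᵇ P xs

    all?≡allᵇ : ∀ x ys → does (all? (R? x) ys) ≡ allᵇ (λ y → does (R? x y)) ys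
    all?≡allᵇ x []       = refl
    all?≡allᵇ x (y ∷ ys) = cong (does (R? x y) ∧_) (all?≡allᵇ x ys)

    allᵇ-∧ : ∀ P Q ys → ⟦ allᵇ P ys ⟧ * ⟦ allᵇ Q ys ⟧ ≡ ⟦ allᵇ (λ y → P y ∧ Q y) ys ⟧
    allᵇ-∧ P Q []       = refl
    allᵇ-∧ P Q (y ∷ ys) with P y | Q y
    ... | true  | true  = allᵇ-∧ P Q ys
    ... | true  | false = *-zeroʳ ⟦ allᵇ P ys ⟧
    ... | false | _     = refl

    -- Generalised over P because the sublists that contain x confine their other entries to
    -- `P ∩R x`.
    ∑-sublists : ∀ P xs → ∑ (sublists xs) (λ ys → ⟦ allᵇ P ys ⟧ * ⟦ does (allPairs? R? ys) ⟧) ≡ indep P xs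
    ∑-sublists P []       = refl
    ∑-sublists P (x ∷ xs) = trans (∑-++ (map (x ∷_) (sublists xs)) (sublists xs) _) (trans
      (cong₂ _+_ (trans (∑-map (x ∷_) (sublists xs) _) (trans (∑-cong (sublists xs) λ ys _ → with-x ys)
        (trans (∑-*ˡ (sublists xs) ⟦ P x ⟧ _) (cong (⟦ P x ⟧ *_) (∑-sublists (P ∩R x) xs))))) (∑-sublists P xs))
      (+-comm _ (indep P xs)))
      where
      lem : ∀ a b c d → a * b * (c * d) ≡ a * (b * c * d)
      lem = solve-∀
      with-x : ∀ ys → ⟦ P x ∧ allᵇ P ys ⟧ * ⟦ does (all? (R? x) ys) ∧ does (allPairs? R? ys) ⟧
                    ≡ ⟦ P x ⟧ * (⟦ allᵇ (P ∩R x) ys ⟧ * ⟦ does (allPairs? R? ys) ⟧)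
      with-x ys = trans
        (cong₂ _*_ (⟦∧⟧ (P x) _) (trans (⟦∧⟧ (does (all? (R? x) ys)) _)
          (cong (λ z → ⟦ z ⟧ * ⟦ does (allPairs? R? ys) ⟧) (all?≡allᵇ x ys))))
        (trans (lem ⟦ P x ⟧ ⟦ allᵇ P ys ⟧ _ _)
          (cong (λ z → ⟦ P x ⟧ * (z * ⟦ does (allPairs? R? ys) ⟧)) (allᵇ-∧ P _ ys)))

    length-filter : ∀ (yss : List (List X)) →
      length (filter (allPairs? R?) yss) ≡ ∑ yss (λ ys → ⟦ does (allPairs? R? ys) ⟧)
    length-filter []         = refl
    length-filter (ys ∷ yss) with does (allPairs? R? ys)
    ... | true  = cong suc (length-filter yss)
    ... | false = length-filter yss

    allᵇ-true : ∀ ys → allᵇ (λ _ → true) ys ≡ true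
    allᵇ-true []       = refl
    allᵇ-true (y ∷ ys) = allᵇ-true ys

  numIndependent : ∀ xs → length (filter (allPairs? R?) (sublists xs)) ≡ indep (λ _ → true) xs
  numIndependent xs = trans (length-filter (sublists xs)) (trans
    (∑-cong (sublists xs) λ ys _ → sym (trans (cong (λ z → ⟦ z ⟧ * ⟦ does (allPairs? R? ys) ⟧) (allᵇ-true ys)) (+-identityʳ _)))
    (∑-sublists (λ _ → true) xs))

allSubsets-unique : ∀ n → Unique (allSubsets n)
allSubsets-unique zero    = [] ∷ []
allSubsets-unique (suc n) = Unique-++⁺ (Unique-map⁺ ∷-injectiveʳ (allSubsets-unique n))
  (Unique-map⁺ ∷-injectiveʳ (allSubsets-unique n)) disjoint
  where
  disjoint : ∀ {A} → ¬ (A ∈ map (inside ∷_) (allSubsets n) × A ∈ map (outside ∷_) (allSubsets n))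
  disjoint (A∈ , A∈′) with ∈-map⁻ (inside ∷_) A∈ | ∈-map⁻ (outside ∷_) A∈′
  ... | _ , _ , refl | _ , _ , ()

∈-allSubsets : ∀ {n} (A : Subset n) → A ∈ allSubsets n
∈-allSubsets []          = here refl
∈-allSubsets (true ∷ A)  = ∈-++⁺ˡ (∈-map⁺ (inside ∷_) (∈-allSubsets A))
∈-allSubsets (false ∷ A) = ∈-++⁺ʳ (map (inside ∷_) (allSubsets _)) (∈-map⁺ (outside ∷_) (∈-allSubsets A))

notTilted-sym : ∀ p q {n} (A B : Subset n) → notTilted p q A B ≡ notTilted p q B A
notTilted-sym p q A B = ∧-comm (not (does (q * ∣ A ─ B ∣ ≟ p * ∣ B ─ A ∣))) _

-- The upper bound

square-cancel : ∀ {x y} → x * x ≤ y * y → x ≤ y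
square-cancel le = ≮⇒≥ λ y<x → <⇒≱ (*-mono-< y<x y<x) le

cube-cancel : ∀ {x y} → x ^ 3 ≤ y ^ 3 → x ≤ y
cube-cancel le = ≮⇒≥ λ y<x → <⇒≱ (^-monoˡ-< 3 y<x) le

*-^ : ∀ x y n → (x * y) ^ n ≡ x ^ n * y ^ n
*-^ x y zero    = refl
*-^ x y (suc n) = trans (cong (x * y *_) (*-^ x y n)) (lem x y (x ^ n) (y ^ n))
  where lem : ∀ x y a b → x * y * (a * b) ≡ x * a * (y * b)
        lem = solve-∀

-- Bernoulli's inequality for (1 + 1/a)^i, cleared of denominators.
bernoulli : ∀ a i → (a + i) * a ^ i ≤ a * suc a ^ i
bernoulli a zero    = ≤-reflexive (lem a)
  where lem : ∀ a → (a + 0) * 1 ≡ a * 1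
        lem = solve-∀
bernoulli a (suc i) = begin
  (a + suc i) * (a * x)         ≤⟨ m≤m+n _ (i * x) ⟩
  (a + suc i) * (a * x) + i * x ≡⟨ lem₁ a i x ⟩
  suc a * ((a + i) * x)         ≤⟨ *-monoʳ-≤ (suc a) (bernoulli a i) ⟩
  suc a * (a * suc a ^ i)       ≡⟨ x∙yz≈y∙xz (suc a) a (suc a ^ i) ⟩
  a * (suc a * suc a ^ i) ∎
  where
  open ≤-Reasoning
  x = a ^ i
  lem₁ : ∀ a i x → (a + suc i) * (a * x) + i * x ≡ suc a * ((a + i) * x)
  lem₁ = solve-∀

-- Bernoulli's inequality for (1 - 1/(a + 1))^i, used to bound (1 + 1/a)^i from above.
bernoulli-reverse : ∀ a i r → i + r ≡ suc a → suc a ^ i * r ≤ a ^ i * suc a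
bernoulli-reverse a zero    r e = ≤-reflexive (cong (1 *_) e)
bernoulli-reverse a (suc i) r e = begin
  suc a * x * r              ≡⟨ lem₁ a x r ⟩
  x * (a * r + r)            ≤⟨ *-monoʳ-≤ x (+-monoʳ-≤ (a * r) (m+n≤o⇒n≤o i (≤-reflexive (suc-injective e)))) ⟩
  x * (a * r + a)            ≡⟨ lem₂ x a r ⟩
  a * (x * suc r)            ≤⟨ *-monoʳ-≤ a (bernoulli-reverse a i (suc r) (trans (+-suc i r) e)) ⟩
  a * (a ^ i * suc a)        ≡⟨ *-assoc a _ _ ⟨
  a * a ^ i * suc a ∎
  where
  open ≤-Reasoning
  x = suc a ^ i
  lem₁ : ∀ a x r → suc a * x * r ≡ x * (a * r + r)
  lem₁ = solve-∀
  lem₂ : ∀ x a r → x * (a * r + a) ≡ a * (x * suc r)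
  lem₂ = solve-∀

module Upper (p q m n t L : ℕ) (p<q : p < q) (1≤t : 1 ≤ t) (1≤m : 1 ≤ m)
  (8qm≤n : 8 * (q * m) ≤ n) (n≤16qm : n ≤ 16 * (q * m))
  (L≤n : L ≤ n)
  (degree≤m : 2 ^ suc L * suc L * suc ((q ∸ p) * t) ≤ m)
  (tail≤ : 4 * q * t * 2 ^ n ≤ m * middleBinom n)
  (extra≤ : 2 * t * 2 ^ n ≤ middleBinom n * 2 ^ suc L) where

  private
    open Window p q m n p<q 1≤m 8qm≤n using (s; near; near-bound; far-bound)
    open Independent {Subset n} (notTilted p q)
    open Deletion (≡-dec Data.Bool._≟_) (notTilted-sym p q)

    S = allSubsets n
    b = middleBinom n
    c = 2 ^ L
    a = pred (2 ^ suc L)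
    e = a * suc L
    K = 2 ^ (n ∸ L)
    -- st + 1 comes from the near sets and 1 from the far ones.
    X = (2 + s * t) * b

    instance
      t≢0 : NonZero t
      t≢0 = >-nonZero 1≤t

    M = X / t

    1≤c : 1 ≤ c
    1≤c = m^n>0 2 L

    b≡ : suc a ≡ 2 ^ suc L
    b≡ = suc-pred (2 ^ suc L) {{m^n≢0 2 (suc L)}}

    1≤a : 1 ≤ a
    1≤a = s≤s⁻¹ (≤-trans (*-monoʳ-≤ 2 1≤c) (≤-reflexive (sym b≡)))

    instance
      a≢0 : NonZero a
      a≢0 = >-nonZero 1≤a

    -- (1 + 1/a)^a ≥ 2 by Bernoulli, so the power e = a(L + 1) reaches 2^(L + 1) = a + 1.
    key : suc a * a ^ suc e ≤ suc a ^ suc e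
    key = begin
      suc a * (a * a ^ e)             ≡⟨ cong (_* (a * a ^ e)) b≡ ⟩
      2 ^ suc L * (a * a ^ e)         ≡⟨ x∙yz≈y∙xz (2 ^ suc L) a (a ^ e) ⟩
      a * (2 ^ suc L * a ^ e)         ≡⟨ cong (λ z → a * (2 ^ suc L * z)) (sym (^-*-assoc a a (suc L))) ⟩
      a * (2 ^ suc L * (a ^ a) ^ suc L) ≡⟨ cong (a *_) (*-^ 2 (a ^ a) (suc L)) ⟨
      a * (2 * a ^ a) ^ suc L         ≤⟨ *-mono-≤ (n≤1+n a) (^-monoˡ-≤ (suc L) 2a^a≤) ⟩
      suc a * (suc a ^ a) ^ suc L     ≡⟨ cong (suc a *_) (^-*-assoc (suc a) a (suc L)) ⟩
      suc a * suc a ^ e ∎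
      where
      open ≤-Reasoning
      2a^a≤ : 2 * a ^ a ≤ suc a ^ a
      2a^a≤ = *-cancelˡ-≤ a (≤-trans (≤-reflexive (lem₁ a (a ^ a))) (bernoulli a a))
        where lem₁ : ∀ a x → a * (2 * x) ≡ (a + a) * x
              lem₁ = solve-∀

    -- Reverse Bernoulli at c = (a + 1)/2 gives (1 + 1/a)^c ≤ 2, and 2^n = c K, so the total weight
    -- is at most 2^K.
    growth : suc a ^ (2 ^ n) ≤ 2 ^ K * a ^ (2 ^ n)
    growth = begin
      suc a ^ (2 ^ n)           ≡⟨ cong (suc a ^_) V≡ ⟩
      suc a ^ (c * K)           ≡⟨ ^-*-assoc (suc a) c K ⟨
      (suc a ^ c) ^ K           ≤⟨ ^-monoˡ-≤ K b^c≤ ⟩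
      (2 * a ^ c) ^ K           ≡⟨ *-^ 2 (a ^ c) K ⟩
      2 ^ K * (a ^ c) ^ K       ≡⟨ cong (2 ^ K *_) (trans (^-*-assoc a c K) (cong (a ^_) (sym V≡))) ⟩
      2 ^ K * a ^ (2 ^ n) ∎
      where
      open ≤-Reasoning
      V≡ : 2 ^ n ≡ c * K
      V≡ = trans (cong (2 ^_) (sym (m+[n∸m]≡n L≤n))) (^-distribˡ-+-* 2 L (n ∸ L))
      c+c≡ : c + c ≡ suc a
      c+c≡ = trans (cong (c +_) (sym (+-identityʳ c))) (sym b≡)
      b^c≤ : suc a ^ c ≤ 2 * a ^ c
      b^c≤ = *-cancelʳ-≤ _ _ c {{>-nonZero 1≤c}} (begin
        suc a ^ c * c          ≤⟨ bernoulli-reverse a c c c+c≡ ⟩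
        a ^ c * suc a          ≡⟨ cong (a ^ c *_) (sym c+c≡) ⟩
        a ^ c * (c + c)        ≡⟨ lem (a ^ c) c ⟩
        2 * a ^ c * c ∎)
        where lem : ∀ x c → x * (c + c) ≡ 2 * x * c
              lem = solve-∀

    far : ℕ
    far = ∑ S (λ A → ⟦ not (near ∣ A ∣) ⟧)

    t*far≤b : t * far ≤ b
    t*far≤b = *-cancelˡ-≤ m {{>-nonZero 1≤m}} (begin
      m * (t * far)          ≡⟨ x∙yz≈y∙xz m t far ⟩
      t * (m * far)          ≤⟨ *-monoʳ-≤ t (far-bound n≤16qm) ⟩
      t * (4 * q * 2 ^ n)    ≡⟨ lem₂ t q (2 ^ n) ⟩
      4 * q * t * 2 ^ n      ≤⟨ tail≤ ⟩
      m * b ∎)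
      where
      open ≤-Reasoning
      lem₂ : ∀ t q v → t * (4 * q * v) ≡ 4 * q * t * v
      lem₂ = solve-∀

    sparse-small : ∀ P → (∀ A → P A ≡ true → degree P A S ≤ e) → count P S ≤ M
    sparse-small P sparse = ≤-trans (≤-reflexive (sym (m*n/n≡m (count P S) t))) (/-monoˡ-≤ t (begin
      count P S * t
        ≡⟨ *-comm _ t ⟩
      t * count P S
        ≤⟨ *-monoʳ-≤ t (∑-mono S λ A _ → split (P A) (near ∣ A ∣)) ⟩
      t * ∑ S (λ A → ⟦ P A ⟧ * ⟦ near ∣ A ∣ ⟧ + ⟦ not (near ∣ A ∣) ⟧)
        ≡⟨ trans (cong (t *_) (∑-+ S _ _)) (*-distribˡ-+ t _ far) ⟩
      t * ∑ S (λ A → ⟦ P A ⟧ * ⟦ near ∣ A ∣ ⟧) + t * far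
        ≤⟨ +-mono-≤ (near-bound P e t sparse e≤m) t*far≤b ⟩
      suc (s * t) * b + b
        ≡⟨ +-comm _ b ⟩
      X ∎))
      where
      open ≤-Reasoning
      e≤m : e * suc (s * t) ≤ m
      e≤m = ≤-trans (*-monoˡ-≤ (suc (s * t)) (*-monoˡ-≤ (suc L) (≤-trans (n≤1+n a) (≤-reflexive b≡)))) degree≤m
      split : ∀ x y → ⟦ x ⟧ ≤ ⟦ x ⟧ * ⟦ y ⟧ + ⟦ not y ⟧
      split false y     = z≤n
      split true  true  = ≤-refl
      split true  false = ≤-refl

    dense : ∀ P → M < count P S → ∃ λ A → A ∈ S × P A ≡ true × suc e ≤ degree P A S
    dense P M<c with any? (λ A → (P A Data.Bool.≟ true) ×-dec (suc e ≤? degree P A S)) S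
    ... | yes found = find found
    ... | no  none  = ⊥-elim (<⇒≱ M<c (sparse-small P λ A PA → ≮⇒≥ λ e<d →
                        none (lose (∈-allSubsets A) (PA , e<d))))

    numTilted≤ : numTiltedSperner p q n ≤ 2 ^ (M + K)
    numTilted≤ = *-cancelʳ-≤ _ _ (a ^ (2 ^ n)) {{m^n≢0 a (2 ^ n)}} (begin
      numTiltedSperner p q n * a ^ (2 ^ n)
        ≡⟨ cong (_* a ^ (2 ^ n)) (numIndependent (notTilted? p q) S) ⟩
      indep (λ _ → true) S * a ^ (2 ^ n)
        ≤⟨ indep-bound S a e M (allSubsets-unique n) key dense (λ _ → true) (2 ^ n) (≤-reflexive (∑-one n)) ⟩
      2 ^ M * suc a ^ (2 ^ n)
        ≤⟨ *-monoʳ-≤ (2 ^ M) growth ⟩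
      2 ^ M * (2 ^ K * a ^ (2 ^ n))
        ≡⟨ trans (sym (*-assoc (2 ^ M) _ _)) (cong (_* a ^ (2 ^ n)) (sym (^-distribˡ-+-* 2 M K))) ⟩
      2 ^ (M + K) * a ^ (2 ^ n) ∎)
      where open ≤-Reasoning

    t*K≤b : t * K ≤ b
    t*K≤b = *-cancelʳ-≤ _ _ (2 ^ suc L) {{m^n≢0 2 (suc L)}} (begin
      t * K * (2 * c)        ≡⟨ lem t K c ⟩
      2 * t * (c * K)        ≡⟨ cong (2 * t *_) (trans (sym (^-distribˡ-+-* 2 L (n ∸ L))) (cong (2 ^_) (m+[n∸m]≡n L≤n))) ⟩
      2 * t * 2 ^ n          ≤⟨ extra≤ ⟩
      b * 2 ^ suc L ∎)
      where
      open ≤-Reasoning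
      lem : ∀ t k c → t * k * (2 * c) ≡ 2 * t * (c * k)
      lem = solve-∀

  upper : numTiltedSperner p q n ^ t ≤ 2 ^ (((q ∸ p) * t + 3) * middleBinom n)
  upper = begin
    numTiltedSperner p q n ^ t     ≤⟨ ^-monoˡ-≤ t numTilted≤ ⟩
    (2 ^ (M + K)) ^ t              ≡⟨ ^-*-assoc 2 (M + K) t ⟩
    2 ^ ((M + K) * t)              ≤⟨ ^-monoʳ-≤ 2 exponent ⟩
    2 ^ ((s * t + 3) * b) ∎
    where
    open ≤-Reasoning
    lem : ∀ x b → (2 + x) * b + b ≡ (x + 3) * b
    lem = solve-∀
    exponent : (M + K) * t ≤ (s * t + 3) * b
    exponent = begin
      (M + K) * t              ≡⟨ *-distribʳ-+ t M K ⟩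
      M * t + K * t            ≤⟨ +-mono-≤ (m/n*n≤m X t) (≤-trans (≤-reflexive (*-comm K t)) t*K≤b) ⟩
      X + b                    ≡⟨ lem (s * t) b ⟩
      (s * t + 3) * b ∎

-- Choice of the parameters

power-of-four : ∀ x → 1 ≤ x → ∃ λ L → x ≤ 4 ^ L × 4 ^ L ≤ 4 * x
power-of-four (suc zero)      _ = 0 , ≤-refl , s≤s z≤n
power-of-four (suc x@(suc _)) _ with power-of-four x (s≤s z≤n)
... | L , x≤ , ≤4x with suc x ≤? 4 ^ L
...   | yes sx≤ = L , sx≤ , ≤-trans ≤4x (*-monoʳ-≤ 4 (n≤1+n x))
...   | no  sx≰ = suc L , ≤-trans (+-mono-≤ (s≤s z≤n) ≤-refl) (≤-trans (≤-reflexive (lem x)) 4x≤) , *-monoʳ-≤ 4 (<⇒≤ (≰⇒> sx≰))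
  where
  4x≤ : x + (x + 0) ≤ 4 ^ suc L
  4x≤ = ≤-trans (*-mono-≤ {2} {4} (s≤s (s≤s z≤n)) x≤) ≤-refl
  lem : ∀ x → x + x ≡ x + (x + 0)
  lem = solve-∀

-- Once L exceeds a constant c, this gives c L 2^L ≤ 4^L, which makes the degree small against n.
square≤2^ : ∀ L → 4 ≤ L → L * L ≤ 2 ^ L
square≤2^ L 4≤L = subst (λ z → z * z ≤ 2 ^ z) (m+[n∸m]≡n 4≤L) (go (L ∸ 4))
  where
  open ≤-Reasoning
  lem : ∀ k → (4 + suc k) * (4 + suc k) + (k * k + 6 * k + 7) ≡ 2 * ((4 + k) * (4 + k))
  lem = solve-∀
  go : ∀ k → (4 + k) * (4 + k) ≤ 2 ^ (4 + k)
  go zero    = ≤-refl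
  go (suc k) = begin
    (4 + suc k) * (4 + suc k)                          ≤⟨ m≤m+n _ (k * k + 6 * k + 7) ⟩
    (4 + suc k) * (4 + suc k) + (k * k + 6 * k + 7)    ≡⟨ lem k ⟩
    2 * ((4 + k) * (4 + k))                            ≤⟨ *-monoʳ-≤ 2 (go k) ⟩
    2 * 2 ^ (4 + k) ∎

4^≡ : ∀ L → 4 ^ L ≡ 2 ^ L * 2 ^ L
4^≡ L = *-^ 2 2 L

module UpperThreshold (p q t : ℕ) (p<q : p < q) (1≤t : 1 ≤ t) where

  private
    g = suc ((q ∸ p) * t)
    -- Each constant comes from a squared inequality with 4^n ≤ 9n B²: Q is (2t)² · 9 from `extra≤`,
    -- and m₀ is (4qt)² · 9 · 16q from `tail≤`. The constant c₀ is what `degree≤m` leaves in front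
    -- of L after scaling by 64 q Q.
    Q = 36 * (t * t)
    m₀ = 16 * (q * q * (t * t)) * (9 * (16 * q))
    c₀ = 64 * (q * (Q * g))

    1≤q : 1 ≤ q
    1≤q = ≤-trans (s≤s z≤n) p<q
    1≤Q : 1 ≤ Q
    1≤Q = ≤-trans (*-mono-≤ 1≤t 1≤t) (m≤n*m (t * t) 36)

    instance
      8q≢0 : NonZero (8 * q)
      8q≢0 = m*n≢0 8 q {{_}} {{>-nonZero 1≤q}}

  -- The first summand forces m > m₀, the second L ≥ 4 + c₀.
  threshold : ℕ
  threshold = 8 * q * suc m₀ + 4 ^ (4 + c₀)

  module _ (n : ℕ) (n≥ : threshold ≤ n) where

    private
      m = n / (8 * q)
      b = middleBinom n

      m₀<m : suc m₀ ≤ m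
      m₀<m = ≤-trans (≤-reflexive (trans (sym (m*n/n≡m (suc m₀) (8 * q))) (cong (_/ (8 * q)) (*-comm (suc m₀) (8 * q)))))
                     (/-monoˡ-≤ (8 * q) (m+n≤o⇒m≤o _ n≥))

      1≤m : 1 ≤ m
      1≤m = ≤-trans (s≤s z≤n) m₀<m

      8qm≤n : 8 * (q * m) ≤ n
      8qm≤n = ≤-trans (≤-reflexive (lem q m)) (m/n*n≤m n (8 * q))
        where lem : ∀ q m → 8 * (q * m) ≡ m * (8 * q)
              lem = solve-∀

      n≤16qm : n ≤ 16 * (q * m)
      n≤16qm = begin
        n                                ≡⟨ m≡m%n+[m/n]*n n (8 * q) ⟩
        n % (8 * q) + m * (8 * q)        ≤⟨ +-monoˡ-≤ (m * (8 * q)) (<⇒≤ (m%n<n n (8 * q))) ⟩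
        8 * q + m * (8 * q)              ≤⟨ +-monoˡ-≤ (m * (8 * q)) (m≤n*m (8 * q) m {{>-nonZero 1≤m}}) ⟩
        m * (8 * q) + m * (8 * q)        ≡⟨ lem q m ⟩
        16 * (q * m) ∎
        where
        open ≤-Reasoning
        lem : ∀ q m → m * (8 * q) + m * (8 * q) ≡ 16 * (q * m)
        lem = solve-∀

      m≤n : m ≤ n
      m≤n = ≤-trans (≤-trans (m≤n*m m q {{>-nonZero 1≤q}}) (m≤n*m (q * m) 8)) 8qm≤n

      1≤n : 1 ≤ n
      1≤n = ≤-trans 1≤m m≤n

      V²≤ : 2 ^ n * 2 ^ n ≤ 9 * n * (b * b)
      V²≤ = ≤-trans (4^n≤middle² n) (*-monoˡ-≤ (b * b) (≤-trans (+-monoˡ-≤ (8 * n) 1≤n) (≤-reflexive (lem n))))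
        where lem : ∀ n → n + 8 * n ≡ 9 * n
              lem = solve-∀

      tail≤ : 4 * q * t * 2 ^ n ≤ m * b
      tail≤ = square-cancel (begin
        4 * q * t * v * (4 * q * t * v)             ≡⟨ lem₁ q t v ⟩
        16 * (q * q * (t * t)) * (v * v)            ≤⟨ *-monoʳ-≤ (16 * (q * q * (t * t))) V²≤ ⟩
        16 * (q * q * (t * t)) * (9 * n * (b * b))  ≤⟨ *-monoʳ-≤ (16 * (q * q * (t * t))) (*-monoˡ-≤ (b * b) (*-monoʳ-≤ 9 n≤16qm)) ⟩
        16 * (q * q * (t * t)) * (9 * (16 * (q * m)) * (b * b)) ≡⟨ lem₂ (16 * (q * q * (t * t))) q m (b * b) ⟩
        m₀ * (m * (b * b))                          ≤⟨ *-monoˡ-≤ (m * (b * b)) (<⇒≤ m₀<m) ⟩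
        m * (m * (b * b))                           ≡⟨ lem₃ m b ⟩
        m * b * (m * b) ∎)
        where
        open ≤-Reasoning
        v = 2 ^ n
        lem₁ : ∀ q t v → 4 * q * t * v * (4 * q * t * v) ≡ 16 * (q * q * (t * t)) * (v * v)
        lem₁ = solve-∀
        lem₂ : ∀ x q m b → x * (9 * (16 * (q * m)) * b) ≡ x * (9 * (16 * q)) * (m * b)
        lem₂ = solve-∀
        lem₃ : ∀ m b → m * (m * (b * b)) ≡ m * b * (m * b)
        lem₃ = solve-∀

    -- The base 2^L of the weights is of order √n with a large constant, which makes 2^n / 2^L
    -- negligible against the middle binomial coefficient, yet L 2^L is still o(n).
    upper-eventually : numTiltedSperner p q n ^ t ≤ 2 ^ (((q ∸ p) * t + 3) * middleBinom n)
    upper-eventually with power-of-four (Q * n) (*-mono-≤ 1≤Q 1≤n)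
    ... | L , Qn≤ , ≤4Qn = from-pred L refl
      where
      open ≤-Reasoning
      c₀<L : 4 + c₀ ≤ L
      c₀<L = ≮⇒≥ λ L< → <⇒≱ (^-monoʳ-< 4 (s≤s (s≤s z≤n)) L<)
        (≤-trans (≤-trans (m+n≤o⇒n≤o (8 * q * suc m₀) n≥) (m≤n*m n Q {{>-nonZero 1≤Q}})) Qn≤)

      degree≤m : 2 ^ L * L * g ≤ m
      degree≤m = *-cancelˡ-≤ (16 * q * (4 * Q)) {{m*n≢0 (16 * q) (4 * Q) {{m*n≢0 16 q {{_}} {{>-nonZero 1≤q}}}} {{m*n≢0 4 Q {{_}} {{>-nonZero 1≤Q}}}}}} (begin
        16 * q * (4 * Q) * (2 ^ L * L * g)   ≡⟨ lem₁ q Q (2 ^ L) L g ⟩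
        2 ^ L * (c₀ * L)                     ≤⟨ *-monoʳ-≤ (2 ^ L) (≤-trans (*-monoˡ-≤ L (m+n≤o⇒n≤o 4 c₀<L)) (square≤2^ L (m+n≤o⇒m≤o 4 c₀<L))) ⟩
        2 ^ L * 2 ^ L                        ≡⟨ 4^≡ L ⟨
        4 ^ L                                ≤⟨ ≤4Qn ⟩
        4 * (Q * n)                          ≤⟨ *-monoʳ-≤ 4 (*-monoʳ-≤ Q n≤16qm) ⟩
        4 * (Q * (16 * (q * m)))             ≡⟨ lem₂ q Q m ⟩
        16 * q * (4 * Q) * m ∎)
        where
        lem₁ : ∀ q Q x L g → 16 * q * (4 * Q) * (x * L * g) ≡ x * (64 * (q * (Q * g)) * L)
        lem₁ = solve-∀
        lem₂ : ∀ q Q m → 4 * (Q * (16 * (q * m))) ≡ 16 * q * (4 * Q) * m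
        lem₂ = solve-∀

      L≤n : L ≤ n
      L≤n = ≤-trans (≤-trans (m≤n*m L (2 ^ L) {{m^n≢0 2 L}}) (m≤m*n (2 ^ L * L) g)) (≤-trans degree≤m m≤n)

      extra≤ : 2 * t * 2 ^ n ≤ b * 2 ^ L
      extra≤ = square-cancel (begin
        2 * t * v * (2 * t * v)          ≡⟨ lem₁ t v ⟩
        4 * (t * t) * (v * v)            ≤⟨ *-monoʳ-≤ (4 * (t * t)) V²≤ ⟩
        4 * (t * t) * (9 * n * (b * b))  ≡⟨ lem₂ (t * t) n (b * b) ⟩
        Q * n * (b * b)                  ≤⟨ *-monoˡ-≤ (b * b) Qn≤ ⟩
        4 ^ L * (b * b)                  ≡⟨ cong (_* (b * b)) (4^≡ L) ⟩
        2 ^ L * 2 ^ L * (b * b)          ≡⟨ lem₃ (2 ^ L) b ⟩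
        b * 2 ^ L * (b * 2 ^ L) ∎)
        where
        v = 2 ^ n
        lem₁ : ∀ t v → 2 * t * v * (2 * t * v) ≡ 4 * (t * t) * (v * v)
        lem₁ = solve-∀
        lem₂ : ∀ t n b → 4 * t * (9 * n * b) ≡ 36 * t * n * b
        lem₂ = solve-∀
        lem₃ : ∀ x b → x * x * (b * b) ≡ b * x * (b * x)
        lem₃ = solve-∀

      -- `Upper` has base 2^(L′ + 1), so that half the base is again an integer.
      from-pred : ∀ L′ → L ≡ L′ → numTiltedSperner p q n ^ t ≤ 2 ^ (((q ∸ p) * t + 3) * middleBinom n)
      from-pred zero     L≡0 = ⊥-elim (1+n≰n (≤-trans (m+n≤o⇒m≤o 1 c₀<L) (≤-reflexive L≡0)))
      from-pred (suc L′) refl = Upper.upper p q m n t L′ p<q 1≤t 1≤m 8qm≤n n≤16qm (<⇒≤ L≤n) degree≤m tail≤ extra≤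

-- The lower bound

-- Both sides are the size of the union.
∣─∣-balance : ∀ {n} (A B : Subset n) → ∣ A ∣ + ∣ B ─ A ∣ ≡ ∣ B ∣ + ∣ A ─ B ∣
∣─∣-balance []          []          = refl
∣─∣-balance (true ∷ A)  (true ∷ B)  = cong suc (∣─∣-balance A B)
∣─∣-balance (true ∷ A)  (false ∷ B) = trans (cong suc (∣─∣-balance A B)) (sym (+-suc ∣ B ∣ _))
∣─∣-balance (false ∷ A) (true ∷ B)  = trans (+-suc ∣ A ∣ _) (cong suc (∣─∣-balance A B))
∣─∣-balance (false ∷ A) (false ∷ B) = ∣─∣-balance A B

∣─∣≡0⇒≡ : ∀ {n} (A B : Subset n) → ∣ A ─ B ∣ ≡ 0 → ∣ B ─ A ∣ ≡ 0 → A ≡ B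
∣─∣≡0⇒≡ []          []          _ _ = refl
∣─∣≡0⇒≡ (true ∷ A)  (true ∷ B)  x y = cong (true ∷_) (∣─∣≡0⇒≡ A B x y)
∣─∣≡0⇒≡ (false ∷ A) (false ∷ B) x y = cong (false ∷_) (∣─∣≡0⇒≡ A B x y)

∑-layer : ∀ n k → ∑ (allSubsets n) (λ A → ⟦ ∣ A ∣ ≡ᵇ k ⟧) ≡ n C k
∑-layer zero    zero    = refl
∑-layer zero    (suc k) = sym (k>n⇒nCk≡0 {0} {suc k} (s≤s z≤n))
∑-layer (suc n) zero    = trans (∑-subsets-suc n _) (trans (∑-layer n zero) (trans (nC0≡1 n) (sym (nC0≡1 (suc n)))))
  where nC0≡1 : ∀ n → n C 0 ≡ 1
        nC0≡1 n = trans (nCk≡nC[n∸k] {0} {n} z≤n) (nCn≡1 n)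
∑-layer (suc n) (suc k) = trans (∑-subsets-suc n _) (trans (∑-+ (allSubsets n) _ _)
  (trans (cong₂ _+_ (∑-layer n k) (∑-layer n (suc k))) (nCk+nC[k+1]≡[n+1]C[k+1] n k)))

-- With l = ⌊n/2⌋, going from level l + r to the next loses at most (2r + 1) B/(l + 1), and the odd
-- numbers add up to r².
layer-large : ∀ n r → let l = ⌊ n /2⌋ in
  suc l * middleBinom n ≤ suc l * (n C (l + r)) + r * r * middleBinom n
layer-large n zero    = ≤-trans (≤-reflexive (cong (λ z → suc ⌊ n /2⌋ * (n C z)) (sym (+-identityʳ ⌊ n /2⌋)))) (m≤m+n _ 0)
layer-large n (suc r) = begin
  suc l * b                                              ≤⟨ layer-large n r ⟩
  suc l * x + r * r * b                                  ≤⟨ +-monoˡ-≤ (r * r * b) (*-monoˡ-≤ x sl≤) ⟩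
  (n ∸ (l + r) + suc r) * x + r * r * b                  ≡⟨ lem₁ (n ∸ (l + r)) r x (r * r * b) ⟩
  x * (n ∸ (l + r)) + suc r * x + r * r * b              ≡⟨ cong (λ z → z + suc r * x + r * r * b) (sym (C-step n (l + r))) ⟩
  y * suc (l + r) + suc r * x + r * r * b                ≡⟨ lem₂ l r x y (r * r * b) ⟩
  suc l * y + (r * y + suc r * x + r * r * b)            ≤⟨ +-monoʳ-≤ (suc l * y) (+-monoˡ-≤ (r * r * b) (+-mono-≤ (*-monoʳ-≤ r (C≤middle n (suc (l + r)))) (*-monoʳ-≤ (suc r) (C≤middle n (l + r))))) ⟩
  suc l * y + (r * b + suc r * b + r * r * b)            ≡⟨ lem₃ (suc l * y) r b ⟩
  suc l * y + suc r * suc r * b                          ≡⟨ cong (λ z → suc l * (n C z) + suc r * suc r * b) (+-suc l r) ⟨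
  suc l * (n C (l + suc r)) + suc r * suc r * b ∎
  where
  open ≤-Reasoning
  l = ⌊ n /2⌋
  b = middleBinom n
  x = n C (l + r)
  y = n C suc (l + r)
  sl≤ : suc l ≤ n ∸ (l + r) + suc r
  sl≤ = ≤-trans (s≤s (+-cancelˡ-≤ l _ _ (begin
    l + l                        ≤⟨ 2half≤ n ⟩
    n                            ≤⟨ m≤n+m∸n n (l + r) ⟩
    l + r + (n ∸ (l + r))        ≡⟨ lem l r (n ∸ (l + r)) ⟩
    l + (n ∸ (l + r) + r) ∎))) (≤-reflexive (sym (+-suc _ r)))
    where lem : ∀ l r z → l + r + z ≡ l + (z + r)
          lem = solve-∀
  lem₁ : ∀ d r x w → (d + suc r) * x + w ≡ x * d + suc r * x + w
  lem₁ = solve-∀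
  lem₂ : ∀ l r x y w → y * suc (l + r) + suc r * x + w ≡ suc l * y + (r * y + suc r * x + w)
  lem₂ = solve-∀
  lem₃ : ∀ z r b → z + (r * b + suc r * b + r * r * b) ≡ z + suc r * suc r * b
  lem₃ = solve-∀

module Lower (p q n : ℕ) (coprime : Coprime p q) (p<q : p < q) where

  private
    s = q ∸ p
    l = ⌊ n /2⌋
    b = middleBinom n
    S = allSubsets n
    s+p≡q : s + p ≡ q
    s+p≡q = m∸n+n≡m (<⇒≤ p<q)
    open Independent {Subset n} (notTilted p q)

    middle : Subset n → Bool
    middle A = interval l (l + s) ∣ A ∣

    -- Coprimality makes q divide |B ─ A|, with quotient t say, so that |A ─ B| = p t and the levels
    -- differ by s t. Within s consecutive levels this forces t = 0, and both differences are empty.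
    untilted : ∀ A B → middle A ≡ true → middle B ≡ true → q * ∣ A ─ B ∣ ≡ p * ∣ B ─ A ∣ → A ≡ B
    untilted A B mA mB tilt with coprime-divisor (Coprimality.sym coprime)
      (divides ∣ A ─ B ∣ (trans (sym tilt) (*-comm q _)))
    ... | divides t y≡ = ∣─∣≡0⇒≡ A B (trans x≡pt (trans (cong (p *_) t≡0) (*-zeroʳ p))) (trans y≡ (cong (_* q) t≡0))
      where
      open ≤-Reasoning
      x = ∣ A ─ B ∣
      y = ∣ B ─ A ∣
      lem₁ : ∀ p t q → p * (t * q) ≡ q * (p * t)
      lem₁ = solve-∀
      x≡pt : x ≡ p * t
      x≡pt = *-cancelˡ-≡ x (p * t) q {{>-nonZero (≤-trans (s≤s z≤n) p<q)}}
        (trans tilt (trans (cong (p *_) y≡) (lem₁ p t q)))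
      lem₂ : ∀ l s t p → l + (s * t + p * t) ≡ l + t * (s + p)
      lem₂ = solve-∀
      lem₃ : ∀ l s x → l + s + x ≡ l + (s * 1 + x)
      lem₃ = solve-∀
      t≡0 : t ≡ 0
      t≡0 = n<1⇒n≡0 (*-cancelˡ-< s t 1 (+-cancelʳ-< (p * t) _ _ (+-cancelˡ-< l _ _ (begin-strict
        l + (s * t + p * t)         ≡⟨ lem₂ l s t p ⟩
        l + t * (s + p)             ≡⟨ cong (λ z → l + t * z) s+p≡q ⟩
        l + t * q                   ≡⟨ cong (l +_) y≡ ⟨
        l + y                       ≤⟨ +-monoˡ-≤ y (proj₁ (interval-bounds l (l + s) ∣ A ∣ mA)) ⟩
        ∣ A ∣ + y                   ≡⟨ ∣─∣-balance A B ⟩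
        ∣ B ∣ + x                   <⟨ +-monoˡ-< x (proj₂ (interval-bounds l (l + s) ∣ B ∣ mB)) ⟩
        l + s + x                   ≡⟨ lem₃ l s x ⟩
        l + (s * 1 + x)             ≡⟨ cong (λ z → l + (s * 1 + z)) x≡pt ⟩
        l + (s * 1 + p * t) ∎))))

    middle-independent : ∀ A B → A ≢ B → middle A ≡ true → middle B ≡ true → notTilted p q A B ≡ true
    middle-independent A B A≢B mA mB = dec-true (notTilted? p q A B)
      ((λ tilt → A≢B (untilted A B mA mB tilt)) , (λ tilt → A≢B (sym (untilted B A mB mA tilt))))

    layers : ℕ
    layers = ∑ (downFrom s) (λ r → n C (l + r))

    layers≤count : layers ≤ count middle S
    layers≤count = begin
      layers
        -- The factor 1 in `1 * r` brings the sum into the form of `∑-at-most-one` with step 1.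
        ≡⟨ ∑-cong (downFrom s) (λ r _ → sym (trans (∑-cong S λ A _ → cong (λ z → ⟦ ∣ A ∣ ≡ᵇ l + z ⟧) (+-identityʳ r)) (∑-layer n (l + r)))) ⟩
      ∑ (downFrom s) (λ r → ∑ S (λ A → ⟦ ∣ A ∣ ≡ᵇ l + 1 * r ⟧))
        ≡⟨ ∑-swap (downFrom s) S _ ⟩
      ∑ S (λ A → ∑ (downFrom s) (λ r → ⟦ ∣ A ∣ ≡ᵇ l + 1 * r ⟧))
        ≤⟨ ∑-mono S (λ A _ → one-layer ∣ A ∣) ⟩
      count middle S ∎
      where
      open ≤-Reasoning
      one-layer : ∀ a → ∑ (downFrom s) (λ r → ⟦ a ≡ᵇ l + 1 * r ⟧) ≤ ⟦ interval l (l + s) a ⟧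
      one-layer a with interval l (l + s) a in e
      ... | true  = ∑-at-most-one s 1 l a ≤-refl
      ... | false = ≤-trans (∑-mono (downFrom s) λ r r∈ → none r (∈-downFrom⁻ r∈)) (≤-reflexive (∑-zero (downFrom s)))
        where
        none : ∀ r → r < s → ⟦ a ≡ᵇ l + 1 * r ⟧ ≤ 0
        none r r<s with a ≡ᵇ l + 1 * r in e′
        ... | false = z≤n
        ... | true  = ⊥-elim (outside-absurd (interval-outside l (l + s) a (cong not e)))
          where
          a≡ : a ≡ l + r
          a≡ = trans (≡ᵇ⇒≡ a _ (subst T (sym e′) _)) (cong (l +_) (+-identityʳ r))
          outside-absurd : ¬ (a < l ⊎ l + s ≤ a)
          outside-absurd (inj₁ a<l)  = <⇒≱ a<l (≤-trans (m≤m+n l r) (≤-reflexive (sym a≡)))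
          outside-absurd (inj₂ hi≤a) = <⇒≱ (+-monoʳ-< l r<s) (≤-trans hi≤a (≤-reflexive a≡))

    layers-large : s * (suc l * b) ≤ suc l * layers + s * (s * s * b)
    layers-large = begin
      s * (suc l * b)
        ≡⟨ trans (cong (_* (suc l * b)) (sym (length-downFrom s))) (sym (∑-const (downFrom s) _)) ⟩
      ∑ (downFrom s) (λ _ → suc l * b)
        ≤⟨ ∑-mono (downFrom s) (λ r r∈ → ≤-trans (layer-large n r)
             (+-monoʳ-≤ _ (*-monoˡ-≤ b (*-mono-≤ (<⇒≤ (∈-downFrom⁻ r∈)) (<⇒≤ (∈-downFrom⁻ r∈)))))) ⟩
      ∑ (downFrom s) (λ r → suc l * (n C (l + r)) + s * s * b)
        ≡⟨ trans (∑-+ (downFrom s) _ _) (cong₂ _+_ (∑-*ˡ (downFrom s) (suc l) _)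
             (trans (∑-const (downFrom s) _) (cong (_* (s * s * b)) (length-downFrom s)))) ⟩
      suc l * layers + s * (s * s * b) ∎
      where open ≤-Reasoning

  -- The s layers together fall short of s B by at most s³ B/(l + 1); the bound on n makes k times
  -- this at most B.
  lower : ∀ k → 2 * (k * (s * s * s)) ≤ n → 2 ^ ((s * k ∸ 1) * b) ≤ numTiltedSperner p q n ^ k
  lower k n≥ = begin
    2 ^ ((s * k ∸ 1) * b)                 ≤⟨ ^-monoʳ-≤ 2 exponent ⟩
    2 ^ (layers * k)                      ≡⟨ ^-*-assoc 2 layers k ⟨
    (2 ^ layers) ^ k                      ≤⟨ ^-monoˡ-≤ k (^-monoʳ-≤ 2 layers≤count) ⟩
    (2 ^ count middle S) ^ k              ≤⟨ ^-monoˡ-≤ k (2^count≤indep middle S (allSubsets-unique n) middle-independent) ⟩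
    indep middle S ^ k                    ≤⟨ ^-monoˡ-≤ k (indep-mono S λ A _ → ⟦⟧≤1 (middle A)) ⟩
    indep (λ _ → true) S ^ k              ≡⟨ cong (_^ k) (numIndependent (notTilted? p q) S) ⟨
    numTiltedSperner p q n ^ k ∎
    where
    open ≤-Reasoning
    ks³≤l : k * (s * s * s) ≤ l
    ks³≤l = half-cancel (≤-trans (≤-reflexive (lem (k * (s * s * s)))) (≤-trans n≥ (≤1+2half n)))
      where lem : ∀ x → x + x ≡ 2 * x
            lem = solve-∀
    skb≤ : s * k * b ≤ b + layers * k
    skb≤ = *-cancelˡ-≤ (suc l) (begin
      suc l * (s * k * b)                                ≡⟨ lem₁ (suc l) s k b ⟩
      k * (s * (suc l * b))                              ≤⟨ *-monoʳ-≤ k layers-large ⟩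
      k * (suc l * layers + s * (s * s * b))             ≡⟨ lem₂ (suc l) s k b layers ⟩
      suc l * (layers * k) + k * (s * s * s) * b         ≤⟨ +-monoʳ-≤ (suc l * (layers * k)) (*-monoˡ-≤ b (≤-trans ks³≤l (n≤1+n l))) ⟩
      suc l * (layers * k) + suc l * b                   ≡⟨ lem₃ (suc l) (layers * k) b ⟩
      suc l * (b + layers * k) ∎)
      where
      lem₁ : ∀ l s k b → l * (s * k * b) ≡ k * (s * (l * b))
      lem₁ = solve-∀
      lem₂ : ∀ l s k b c → k * (l * c + s * (s * s * b)) ≡ l * (c * k) + k * (s * s * s) * b
      lem₂ = solve-∀
      lem₃ : ∀ l c b → l * c + l * b ≡ l * (b + c)
      lem₃ = solve-∀
    exponent : (s * k ∸ 1) * b ≤ layers * k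
    exponent = ≤-trans (≤-reflexive (trans (*-distribʳ-∸ b (s * k) 1) (cong (s * k * b ∸_) (*-identityˡ b))))
      (m≤n+o⇒m∸n≤o (s * k * b) b skb≤)

theorem4p1 : (p q : ℕ) → Coprime p q → p < q →
    (k : ℕ) → Σ ℕ (λ n₀ → (n : ℕ) → n₀ ≤ n →
    (2 ^ (((q ∸ p) * suc k ∸ 1) * middleBinom n) ≤ numTiltedSperner p q n ^ suc k)
    × (numTiltedSperner p q n ^ suc k ≤ 2 ^ (((q ∸ p) * suc k + 1) * middleBinom n)))
theorem4p1 p q coprime p<q k = lowerThreshold + threshold , λ n n≥ →
    Lower.lower p q n coprime p<q (suc k) (m+n≤o⇒m≤o lowerThreshold n≥)
  -- With t = 3(k + 1) the error 3/t of the upper bound is 1/(k + 1), and the bound is the cube of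
  -- the one wanted.
  , cube-cancel (begin
      (numTiltedSperner p q n ^ suc k) ^ 3                 ≡⟨ ^-*-assoc (numTiltedSperner p q n) (suc k) 3 ⟩
      numTiltedSperner p q n ^ (suc k * 3)                 ≤⟨ upper-eventually n (m+n≤o⇒n≤o lowerThreshold n≥) ⟩
      2 ^ (((q ∸ p) * (suc k * 3) + 3) * middleBinom n)    ≡⟨ cong (2 ^_) (lem (q ∸ p) k (middleBinom n)) ⟩
      2 ^ (((q ∸ p) * suc k + 1) * middleBinom n * 3)      ≡⟨ ^-*-assoc 2 (((q ∸ p) * suc k + 1) * middleBinom n) 3 ⟨
      (2 ^ (((q ∸ p) * suc k + 1) * middleBinom n)) ^ 3 ∎)
  where
  open ≤-Reasoning
  open UpperThreshold p q (suc k * 3) p<q (s≤s z≤n) using (threshold; upper-eventually)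
  lowerThreshold = 2 * (suc k * ((q ∸ p) * (q ∸ p) * (q ∸ p)))
  lem : ∀ s k b → (s * (suc k * 3) + 3) * b ≡ (s * suc k + 1) * b * 3
  lem = solve-∀
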